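{- Let $G$ be a simple graph, let $f : V(G) \to \mathbb{Z}_{\ge 2}$ be a function, and let $d = \max\{\Delta_f(G), a(G)\}$. If $G$ has girth $g \ge 4d$, then $a_f(G) \le d + 1$.
   Context: For a graph $G$ and a function $f : V(G) \to \mathbb{Z}_{\ge 2}$, a degree-$f$ forest of $G$ is a spanning subgraph that is a forest in which every vertex $v$ has degree at most $f(v)$. The degree-$f$ arboricity $a_f(G)$ is the minimum number of colors in an edge-coloring of $G$ in which every color class is a degree-$f$ forest. The arboricity $a(G)$ is the minimum number of colors in an edge-coloring of $G$ in which every color class is a forest. $\Delta_f(G) = \max_{v \in V(G)} \lceil d(v)/f(v) \rceil$, where $d(v)$ is the degree of $v$. The girth is the length of a shortest cycle (infinite if $G$ is a forest). -}

module Defs where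

open import Data.Nat using (ℕ; zero; suc; _+_; _*_; _∸_; _≤_; _⊔_)
open import Data.Nat.DivMod using (_/_)
open import Data.Fin using (Fin; zero; suc; toℕ; _≟_)
open import Data.Bool using (Bool; true; false; if_then_else_; _∧_)
open import Data.Product using (Σ; ∃; _×_; _,_)
open import Data.Sum using (_⊎_)
open import Data.Unit using (⊤)
open import Relation.Nullary using (¬_)
open import Relation.Nullary.Decidable using (⌊_⌋)
open import Relation.Binary.PropositionalEquality using (_≡_)
open import Function.Definitions using (Injective)

record Graph : Set where
  field
    n      : ℕ
    adj    : Fin n → Fin n → Bool
    sym    : ∀ u v → adj u v ≡ adj v u
    irrefl : ∀ v → adj v v ≡ false
open Graph public

count : ∀ {m} → (Fin m → Bool) → ℕ
count {zero}  p = 0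
count {suc m} p = (if p zero then 1 else 0) + count (λ i → p (suc i))

maxFin : ∀ {m} → (Fin m → ℕ) → ℕ
maxFin {zero}  h = 0
maxFin {suc m} h = h zero ⊔ maxFin (λ i → h (suc i))

-- Ceiling division ⌈a / b⌉ (only used with b ≥ 2; value 0 for b = 0).
ceilDiv : ℕ → ℕ → ℕ
ceilDiv a zero    = 0
ceilDiv a (suc b) = (a + b) / suc b

degree : (G : Graph) → Fin (n G) → ℕ
degree G v = count (λ w → adj G v w)

Δf : (G : Graph) → (Fin (n G) → ℕ) → ℕ
Δf G f = maxFin (λ v → ceilDiv (degree G v) (f v))

CycNext : ∀ {ℓ} → Fin ℓ → Fin ℓ → Set
CycNext {ℓ} i j = (suc (toℕ i) ≡ toℕ j) ⊎ ((suc (toℕ i) ≡ ℓ) × (toℕ j ≡ 0))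

record CycleIn (G : Graph) (P : Fin (n G) → Fin (n G) → Set) (ℓ : ℕ) : Set where
  field
    len≥3 : 3 ≤ ℓ
    vs    : Fin ℓ → Fin (n G)
    inj   : Injective _≡_ _≡_ vs
    edge  : ∀ i j → CycNext i j → adj G (vs i) (vs j) ≡ true
    prop  : ∀ i j → CycNext i j → P (vs i) (vs j)

-- Every cycle of G has length ≥ g  (girth ≥ g; vacuous for forests).
GirthAtLeast : Graph → ℕ → Set
GirthAtLeast G g = ∀ ℓ → CycleIn G (λ _ _ → ⊤) ℓ → g ≤ ℓ

-- An edge-colouring of G with k colours: a colour for every ordered pair,
-- symmetric on edges (only values on edges matter).
record EdgeColouring (G : Graph) (k : ℕ) : Set where
  field
    col    : Fin (n G) → Fin (n G) → Fin k
    colSym : ∀ u v → adj G u v ≡ true → col u v ≡ col v u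
open EdgeColouring public

ClassIsForest : ∀ {G k} → EdgeColouring G k → Fin k → Set
ClassIsForest {G} c i = ∀ ℓ → ¬ CycleIn G (λ u v → col c u v ≡ i) ℓ

colDegree : ∀ {G k} → EdgeColouring G k → Fin k → Fin (n G) → ℕ
colDegree {G} c i v = count (λ w → adj G v w ∧ ⌊ col c v w ≟ i ⌋)

ForestColouring : (G : Graph) → ℕ → Set
ForestColouring G k = Σ (EdgeColouring G k) (λ c → ∀ i → ClassIsForest c i)

DegFForestColouring : (G : Graph) → (Fin (n G) → ℕ) → ℕ → Set
DegFForestColouring G f k =
  Σ (EdgeColouring G k) (λ c → ∀ i → ClassIsForest c i × (∀ v → colDegree c i v ≤ f v))

IsArboricity : Graph → ℕ → Set
IsArboricity G a = ForestColouring G a × (∀ k → ForestColouring G k → a ≤ k)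

{-# OPTIONS --safe #-}

-- Let d be the maximum of Δ_f(G) and a(G). Orienting the forests of an optimal forest colouring towards
-- their roots gives an orientation of G with out-degrees at most d. As every degree is at most d f(v),
-- reversing directed paths makes the in-degrees at most d (f(v) - 1) as well, and Kempe changes (as in
-- König's edge colouring theorem) split the arcs into d classes with out-degree at most 1 and in-degree at
-- most f(v) - 1. Each class satisfies the degree bound, and its cycles are directed, pairwise disjoint and
-- of length at least 4d. It remains to remove one arc from every cycle in such a way that the removed arcs
-- form disjoint directed paths, and hence a class d + 1 with degrees at most 2.
--
-- The removed arcs are found by a Haxell-type alternating tree. To serve a new cycle, arcs e₁, e₂, … are
-- considered, each on the new cycle or on the cycle of an earlier blocker, and each blocked by a selected
-- arc s_i with the same tail, with the same head, or entering the tail of e_i. A step (e_i, s_i) rules out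
-- only the arcs at four vertex-sides, hence at most 4d arcs, while k steps involve k + 1 cycles with at
-- least 4d arcs each, so a further arc is always available. An unblocked arc replaces the blocker
-- on its own cycle and the tree shrinks.
module Submission where

open import Defs
open import Data.Nat as ℕ using (ℕ; zero; suc; _+_; _*_; _∸_; _≤_; _<_; _⊔_; _⊓_; z≤n; s≤s; s≤s⁻¹; _<?_)
open import Data.Nat.Properties hiding (suc-injective; 0≢1+n; _≟_)
open import Data.Nat.DivMod using (_/_; _%_; m≡m%n+[m/n]*n; m%n<n)
open import Data.Fin using (Fin; zero; suc; _≟_; toℕ; fromℕ<; splitAt; _↑ˡ_; _↑ʳ_)
open import Data.Fin.Properties
  using (any?; suc-injective; 0≢1+n; splitAt-↑ˡ; splitAt-↑ʳ; pigeonhole; toℕ<n; toℕ-fromℕ<; toℕ-injective; injective⇒≤)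
open import Data.Bool using (Bool; true; false; if_then_else_; _∧_; _∨_; not)
import Data.Bool.Properties as Bool
open import Data.Maybe using (Maybe; just; nothing; maybe′; _<∣>_)
open import Data.Maybe.Properties using (≡-dec; just-injective)
open import Data.Product using (Σ; ∃; ∃₂; _×_; _,_; proj₁; proj₂)
import Data.Product.Properties as Prod
open import Data.Sum using (_⊎_; inj₁; inj₂) renaming (swap to swap⊎)
open import Data.List using (List; []; _∷_; _++_; length; map; filter; allFin; applyUpTo; cartesianProduct)
open import Data.List.Properties using (length-++; length-map; length-applyUpTo; length-tabulate)
open import Data.List.Membership.Propositional using (_∈_; _∉_; find)
open import Data.List.Membership.Propositional.Properties
  using (∈-∃++; ∈-++⁻; ∈-++⁺ˡ; ∈-++⁺ʳ; ∈-filter⁺; ∈-filter⁻; ∈-allFin; ∈-cartesianProduct⁺; ∈-map⁺; ∈-map⁻; ∈-applyUpTo⁻)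
import Data.List.Membership.DecPropositional as DecMembership
open import Data.List.Relation.Unary.Any as Any using (here; there)
open import Data.List.Relation.Unary.All as All using (All; []; _∷_)
import Data.List.Relation.Unary.All.Properties as All
open import Data.List.Relation.Unary.AllPairs using ([]; _∷_)
open import Data.List.Relation.Unary.Unique.Propositional using (Unique)
import Data.List.Relation.Unary.Unique.Propositional.Properties as Unique
open import Data.Unit using (⊤; tt)
open import Data.Empty using (⊥; ⊥-elim)
open import Function using (_∘_; case_of_)
open import Relation.Nullary using (¬_; Dec; yes; no; contradiction)
open import Relation.Nullary.Decidable using (⌊_⌋; _×-dec_; ¬?)
open import Relation.Binary.Definitions using (DecidableEquality; tri<; tri≈; tri>)
open import Relation.Binary.PropositionalEquality
  using (_≡_; _≢_; refl; trans; cong; cong₂; subst; subst₂; module ≡-Reasoning)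
  renaming (sym to ≡-sym)
open import Algebra.Properties.CommutativeMonoid.Sum +-0-commutativeMonoid
  using (sum; sum-cong-≗; ∑-distrib-+; ∑-comm)

private variable
  m N : ℕ

-- Counting, and balancing orientations by path reversal

true≢false : true ≢ false
true≢false ()

𝟙 : Bool → ℕ
𝟙 b = if b then 1 else 0

𝟙-mono : ∀ {b c} → (b ≡ true → c ≡ true) → 𝟙 b ≤ 𝟙 c
𝟙-mono {false}         _ = z≤n
𝟙-mono {true}  {true}  _ = ≤-refl
𝟙-mono {true}  {false} h = contradiction (≡-sym (h refl)) true≢false

sum-mono : {f g : Fin m → ℕ} → (∀ i → f i ≤ g i) → sum f ≤ sum g
sum-mono {zero}  h = z≤n
sum-mono {suc m} h = +-mono-≤ (h zero) (sum-mono (h ∘ suc))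

sum-mono-< : {f g : Fin m → ℕ} → (∀ i → f i ≤ g i) → ∀ i → f i < g i → sum f < sum g
sum-mono-< h zero    lt = +-mono-<-≤ lt (sum-mono (h ∘ suc))
sum-mono-< h (suc i) lt = +-mono-≤-< (h zero) (sum-mono-< (h ∘ suc) i lt)

sum-const : ∀ m k → sum {m} (λ _ → k) ≡ m * k
sum-const zero    k = refl
sum-const (suc m) k = cong (k +_) (sum-const m k)

count≡sum : (p : Fin m → Bool) → count p ≡ sum (𝟙 ∘ p)
count≡sum {zero}  p = refl
count≡sum {suc m} p = cong (𝟙 (p zero) +_) (count≡sum (p ∘ suc))

count-cong : {p q : Fin m → Bool} → (∀ i → p i ≡ q i) → count p ≡ count q
count-cong {zero}  h = refl
count-cong {suc m} h = cong₂ _+_ (cong 𝟙 (h zero)) (count-cong (h ∘ suc))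

count-mono : {p q : Fin m → Bool} → (∀ i → p i ≡ true → q i ≡ true) → count p ≤ count q
count-mono {zero}  h = z≤n
count-mono {suc m} h = +-mono-≤ (𝟙-mono (h zero)) (count-mono (h ∘ suc))

count-∪ : {p q r : Fin m → Bool} → (∀ i → p i ≡ true → q i ≡ true ⊎ r i ≡ true) →
          count p ≤ count q + count r
count-∪ {p = p} {q} {r} h = begin
  count p                            ≡⟨ count≡sum p ⟩
  sum (𝟙 ∘ p)                        ≤⟨ sum-mono (λ i → pointwise (p i) (q i) (r i) (h i)) ⟩
  sum (λ i → 𝟙 (q i) + 𝟙 (r i))      ≡⟨ ∑-distrib-+ (𝟙 ∘ q) (𝟙 ∘ r) ⟩
  sum (𝟙 ∘ q) + sum (𝟙 ∘ r)          ≡⟨ cong₂ _+_ (count≡sum q) (count≡sum r) ⟨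
  count q + count r                  ∎
  where
  open ≤-Reasoning
  pointwise : ∀ a b c → (a ≡ true → b ≡ true ⊎ c ≡ true) → 𝟙 a ≤ 𝟙 b + 𝟙 c
  pointwise false b     c     _ = z≤n
  pointwise true  true  c     _ = s≤s z≤n
  pointwise true  false true  _ = ≤-refl
  pointwise true  false false k with k refl
  ... | inj₁ ()
  ... | inj₂ ()

count-disjoint : {p q r : Fin m → Bool} → (∀ i → q i ≡ true → p i ≡ true) → (∀ i → r i ≡ true → p i ≡ true) →
                 (∀ i → q i ≡ true → r i ≡ true → ⊥) → count q + count r ≤ count p
count-disjoint {p = p} {q} {r} hq hr hd = begin
  count q + count r                  ≡⟨ cong₂ _+_ (count≡sum q) (count≡sum r) ⟩
  sum (𝟙 ∘ q) + sum (𝟙 ∘ r)          ≡⟨ ∑-distrib-+ (𝟙 ∘ q) (𝟙 ∘ r) ⟨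
  sum (λ i → 𝟙 (q i) + 𝟙 (r i))      ≤⟨ sum-mono (λ i → pointwise (p i) (q i) (r i) (hq i) (hr i) (hd i)) ⟩
  sum (𝟙 ∘ p)                        ≡⟨ count≡sum p ⟨
  count p                            ∎
  where
  open ≤-Reasoning
  pointwise : ∀ a b c → (b ≡ true → a ≡ true) → (c ≡ true → a ≡ true) → (b ≡ true → c ≡ true → ⊥) →
              𝟙 b + 𝟙 c ≤ 𝟙 a
  pointwise a false false _ _ _ = z≤n
  pointwise a false true  _ h _ rewrite h refl = ≤-refl
  pointwise a true  false h _ _ rewrite h refl = ≤-refl
  pointwise a true  true  _ _ k = ⊥-elim (k refl refl)

count≡0 : {p : Fin m → Bool} → (∀ i → p i ≡ true → ⊥) → count p ≡ 0
count≡0 {zero}          h = refl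
count≡0 {suc m} {p = p} h with p zero in eq
... | true  = ⊥-elim (h zero eq)
... | false = count≡0 (h ∘ suc)

count≤1 : {p : Fin m → Bool} → (∀ i j → p i ≡ true → p j ≡ true → i ≡ j) → count p ≤ 1
count≤1 {zero}          h = z≤n
count≤1 {suc m} {p = p} h with p zero in eq
... | true  = s≤s (≤-reflexive (count≡0 (λ i pi → 0≢1+n (h zero (suc i) eq pi))))
... | false = count≤1 (λ i j pi pj → suc-injective (h (suc i) (suc j) pi pj))

count>0 : {p : Fin m → Bool} → ∀ i → p i ≡ true → 0 < count p
count>0 {p = p} zero    pi rewrite pi = s≤s z≤n
count>0 {p = p} (suc i) pi = ≤-trans (count>0 i pi) (m≤n+m _ (𝟙 (p zero)))

count≤1⇒unique : {p : Fin m → Bool} → count p ≤ 1 → ∀ i j → p i ≡ true → p j ≡ true → i ≡ j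
count≤1⇒unique {p = p} h zero zero pi pj = refl
count≤1⇒unique {p = p} h zero (suc j) pi pj rewrite pi =
  contradiction (≤-trans (count>0 j pj) (s≤s⁻¹ h)) λ ()
count≤1⇒unique {p = p} h (suc i) zero pi pj rewrite pj =
  contradiction (≤-trans (count>0 i pi) (s≤s⁻¹ h)) λ ()
count≤1⇒unique {p = p} h (suc i) (suc j) pi pj =
  cong suc (count≤1⇒unique (≤-trans (m≤n+m _ (𝟙 (p zero))) h) i j pi pj)

count-insert : {p q : Fin m → Bool} → ∀ i → p i ≡ false → q i ≡ true →
               (∀ j → j ≢ i → p j ≡ q j) → count q ≡ suc (count p)
count-insert {suc m} {p} {q} zero pi qi h rewrite pi | qi =
  cong suc (count-cong (λ j → ≡-sym (h (suc j) λ ())))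
count-insert {suc m} {p} {q} (suc i) pi qi h
  rewrite h zero (λ ())
        | count-insert {p = p ∘ suc} {q ∘ suc} i pi qi (λ j ne → h (suc j) (ne ∘ suc-injective)) =
  +-suc (𝟙 (q zero)) _

-- Orientations as Boolean arc matrices

Arcs : ℕ → Set
Arcs N = Fin N → Fin N → Bool

indeg outdeg : Arcs N → Fin N → ℕ
indeg  O v = count (λ u → O u v)
outdeg O v = count (λ w → O v w)

Asym : Arcs N → Set
Asym O = ∀ u v → O u v ≡ true → O v u ≡ true → ⊥

-- The two arc sets have the same underlying undirected edges. This is all that is kept when paths
-- are reversed, and it suffices to preserve total degrees.
record Reorients {N} (O O′ : Arcs N) : Set where
  field
    asym′ : Asym O′
    to    : ∀ {u v} → O u v ≡ true → O′ u v ≡ true ⊎ O′ v u ≡ true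
    from  : ∀ {u v} → O′ u v ≡ true → O u v ≡ true ⊎ O v u ≡ true
open Reorients

reorients-refl : {O : Arcs N} → Asym O → Reorients O O
reorients-refl as = record { asym′ = as ; to = inj₁ ; from = inj₁ }

reorients-trans : {O P Q : Arcs N} → Reorients O P → Reorients P Q → Reorients O Q
reorients-trans r s = record
  { asym′ = asym′ s
  ; to    = λ h → case to r h of λ { (inj₁ k) → to s k ; (inj₂ k) → swap⊎ (to s k) }
  ; from  = λ h → case from s h of λ { (inj₁ k) → from r k ; (inj₂ k) → swap⊎ (from r k) } }

∨-true : ∀ {b c} → b ∨ c ≡ true → b ≡ true ⊎ c ≡ true
∨-true {true}  h = inj₁ refl
∨-true {false} h = inj₂ h

∨-trueˡ : ∀ {b} c → b ≡ true → b ∨ c ≡ true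
∨-trueˡ c refl = refl

∨-trueʳ : ∀ b {c} → c ≡ true → b ∨ c ≡ true
∨-trueʳ true  refl = refl
∨-trueʳ false refl = refl

-- Asymmetry makes in- and out-neighbourhoods disjoint, so both sides count their union; the
-- right-hand side depends only on the underlying graph.
in+out : {O : Arcs N} → Asym O → ∀ v → indeg O v + outdeg O v ≡ count (λ u → O u v ∨ O v u)
in+out {O = O} as v = ≤-antisym
  (count-disjoint {p = λ u → O u v ∨ O v u} {λ u → O u v} {O v}
    (λ u → ∨-trueˡ (O v u)) (λ u → ∨-trueʳ (O u v)) (λ u → as u v))
  (count-∪ {p = λ u → O u v ∨ O v u} {λ u → O u v} {O v} (λ u → ∨-true))

degree-preserved : {O O′ : Arcs N} → Asym O → Reorients O O′ → ∀ v →
                   indeg O′ v + outdeg O′ v ≡ indeg O v + outdeg O v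
degree-preserved {O = O} {O′} as r v = begin
  indeg O′ v + outdeg O′ v          ≡⟨ in+out (asym′ r) v ⟩
  count (λ u → O′ u v ∨ O′ v u)     ≡⟨ ≤-antisym (adj-mono O′ O (from r)) (adj-mono O O′ (to r)) ⟩
  count (λ u → O u v ∨ O v u)       ≡⟨ in+out as v ⟨
  indeg O v + outdeg O v            ∎
  where
  open ≡-Reasoning
  join : ∀ {b c} → b ≡ true ⊎ c ≡ true → b ∨ c ≡ true
  join {b} {c} (inj₁ h) = ∨-trueˡ c h
  join {b} {c} (inj₂ h) = ∨-trueʳ b h
  adj-mono : ∀ P Q → (∀ {u v} → P u v ≡ true → Q u v ≡ true ⊎ Q v u ≡ true) →
             count (λ u → P u v ∨ P v u) ≤ count (λ u → Q u v ∨ Q v u)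
  adj-mono P Q f = count-mono {p = λ u → P u v ∨ P v u} {λ u → Q u v ∨ Q v u} λ u h →
    case ∨-true h of λ { (inj₁ k) → join (f k) ; (inj₂ k) → join (swap⊎ (f k)) }

flip : Arcs N → Fin N → Fin N → Arcs N
flip O s t a b = if ⌊ a ≟ t ⌋ ∧ ⌊ b ≟ s ⌋ then true else
                 if ⌊ a ≟ s ⌋ ∧ ⌊ b ≟ t ⌋ then false else O a b

module Flip {O : Arcs N} (as : Asym O) {s t : Fin N} (st : O s t ≡ true) where

  s≢t : s ≢ t
  s≢t refl = as s s st st

  new : flip O s t t s ≡ true
  new with t ≟ t | s ≟ s
  ... | yes _ | yes _ = refl
  ... | no ne | _     = contradiction refl ne
  ... | _     | no ne = contradiction refl ne

  old : flip O s t s t ≡ false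
  old with s ≟ t | t ≟ s | s ≟ s | t ≟ t
  ... | yes e | _ | _ | _ = contradiction e s≢t
  ... | no _ | _ | yes _ | yes _ = refl
  ... | no _ | _ | no ne | _ = contradiction refl ne
  ... | no _ | _ | _ | no ne = contradiction refl ne

  other : ∀ a b → (a ≡ t → b ≡ s → ⊥) → (a ≡ s → b ≡ t → ⊥) → flip O s t a b ≡ O a b
  other a b h k with a ≟ t | b ≟ s
  ... | yes p | yes q = ⊥-elim (h p q)
  ... | yes p | no _ with a ≟ s
  ...   | yes e = contradiction (trans (≡-sym e) p) s≢t
  ...   | no _  = refl
  other a b h k | no _ | _ with a ≟ s | b ≟ t
  ... | yes p | yes q = ⊥-elim (k p q)
  ... | yes _ | no _  = refl
  ... | no _  | _     = refl

  data View (a b : Fin N) : Set where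
    isNew : a ≡ t → b ≡ s → View a b
    isOld : a ≡ s → b ≡ t → View a b
    isOther : flip O s t a b ≡ O a b → View a b

  view : ∀ a b → View a b
  view a b with a ≟ t | b ≟ s | a ≟ s | b ≟ t
  ... | yes p | yes q | _ | _ = isNew p q
  ... | _ | _ | yes p | yes q = isOld p q
  ... | no p | _ | no q | _ = isOther (other a b (λ e → contradiction e p) (λ e → contradiction e q))
  ... | no p | _ | _ | no q = isOther (other a b (λ e → contradiction e p) (λ _ e → contradiction e q))
  ... | _ | no p | no q | _ = isOther (other a b (λ _ e → contradiction e p) (λ e → contradiction e q))
  ... | _ | no p | _ | no q = isOther (other a b (λ _ e → contradiction e p) (λ _ e → contradiction e q))

  reorients : Reorients O (flip O s t)
  reorients = record { asym′ = asy ; to = λ {u} {v} → t₁ u v ; from = λ {u} {v} → f₁ u v }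
    where
    asy : Asym (flip O s t)
    asy u v p q with view u v | view v u
    ... | isNew refl refl | _ = contradiction (trans (≡-sym q) old) true≢false
    ... | isOld refl refl | _ = contradiction (trans (≡-sym p) old) true≢false
    ... | isOther _ | isNew refl refl = contradiction (trans (≡-sym p) old) true≢false
    ... | isOther _ | isOld refl refl = contradiction (trans (≡-sym q) old) true≢false
    ... | isOther e | isOther e′ = as u v (trans (≡-sym e) p) (trans (≡-sym e′) q)
    t₁ : ∀ u v → O u v ≡ true → flip O s t u v ≡ true ⊎ flip O s t v u ≡ true
    t₁ u v h with view u v
    ... | isNew refl refl = inj₁ new
    ... | isOld refl refl = inj₂ new
    ... | isOther e = inj₁ (trans e h)
    f₁ : ∀ u v → flip O s t u v ≡ true → O u v ≡ true ⊎ O v u ≡ true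
    f₁ u v h with view u v
    ... | isNew refl refl = inj₂ st
    ... | isOld refl refl = inj₁ st
    ... | isOther e = inj₁ (trans (≡-sym e) h)

δ : Fin N → Fin N → ℕ
δ x z = 𝟙 ⌊ x ≟ z ⌋

δ-refl : ∀ (x : Fin N) → δ x x ≡ 1
δ-refl x with x ≟ x
... | yes _ = refl
... | no ne = contradiction refl ne

δ-≢ : ∀ {x z : Fin N} → x ≢ z → δ x z ≡ 0
δ-≢ {x = x} {z} ne with x ≟ z
... | yes e = contradiction e ne
... | no _  = refl

-- The indicators `δ` on both sides avoid subtraction and telescope when the arcs of a path are
-- reversed one after another.
flip-indeg : {O : Arcs N} (as : Asym O) {s t : Fin N} → O s t ≡ true → ∀ z →
             indeg (flip O s t) z + δ t z ≡ indeg O z + δ s z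
flip-indeg {O = O} as {s} {t} st z = cases (z ≟ t) (z ≟ s)
  where
  module F = Flip as st
  ts : O t s ≡ false
  ts with O t s in eq
  ... | true  = ⊥-elim (as t s eq st)
  ... | false = refl
  cases : Dec (z ≡ t) → Dec (z ≡ s) → indeg (flip O s t) z + δ t z ≡ indeg O z + δ s z
  cases (yes refl) _ rewrite δ-refl z | δ-≢ F.s≢t =
    trans (+-comm _ 1) (trans (≡-sym (count-insert s F.old st
      (λ j ne → F.other j z (λ _ e → F.s≢t (≡-sym e)) (λ e _ → ne e)))) (≡-sym (+-identityʳ _)))
  cases (no z≢t) (yes refl) rewrite δ-refl z | δ-≢ (z≢t ∘ ≡-sym) =
    trans (+-identityʳ _) (trans (count-insert t ts F.new
      (λ j ne → ≡-sym (F.other j z (λ e _ → ne e) (λ _ e → F.s≢t e)))) (≡-sym (+-comm _ 1)))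
  cases (no z≢t) (no z≢s) rewrite δ-≢ (z≢t ∘ ≡-sym) | δ-≢ (z≢s ∘ ≡-sym) =
    cong (_+ 0) (count-cong (λ j → F.other j z (λ _ → z≢s) (λ _ → z≢t)))

-- A directed path from `w` to `v`, extended at its end `v`; every vertex of it occurs in `v ∷ xs`,
-- which may also contain others. The condition on `v` keeps the rest of the path untouched when the
-- arc into `v` is reversed.
data Path (O : Arcs N) (w : Fin N) : Fin N → List (Fin N) → Set where
  [_]  : ∀ {xs} → Path O w w xs
  step : ∀ {v y xs} → O y v ≡ true → v ∉ (y ∷ xs) → Path O w y xs → Path O w v (y ∷ xs)

path-map : {O O′ : Arcs N} {w v : Fin N} {xs : List (Fin N)} →
           (∀ a b → a ∈ v ∷ xs → b ∈ v ∷ xs → O a b ≡ true → O′ a b ≡ true) →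
           Path O w v xs → Path O′ w v xs
path-map h [_] = [_]
path-map h (step e n p) =
  step (h _ _ (there (here refl)) (here refl) e) n (path-map (λ a b i j → h a b (there i) (there j)) p)

-- The last arc is reversed first; the remaining path avoids `v` and survives. The contributions of
-- inner vertices cancel, so only `v` loses and only `w` gains an incoming arc.
flipPath : {O : Arcs N} {w v : Fin N} {xs : List (Fin N)} → Asym O → Path O w v xs →
           Σ (Arcs N) λ O′ → Reorients O O′ × (∀ z → indeg O′ z + δ v z ≡ indeg O z + δ w z)
flipPath as [_] = _ , reorients-refl as , λ z → refl
flipPath {O = O} {w} {v} as (step {y = y} {xs} yv v∉ p)
  = let O′ , r , eq = flipPath (asym′ (Flip.reorients as yv)) (path-map keep p) in
    O′ , reorients-trans (Flip.reorients as yv) r , λ z → +-cancelʳ-≡ (δ y z) _ _ (begin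
    indeg O′ z + δ v z + δ y z      ≡⟨ swapʳ (indeg O′ z) (δ v z) (δ y z) ⟩
    indeg O′ z + δ y z + δ v z      ≡⟨ cong (_+ δ v z) (eq z) ⟩
    indeg O₁ z + δ w z + δ v z      ≡⟨ swapʳ (indeg O₁ z) (δ w z) (δ v z) ⟩
    indeg O₁ z + δ v z + δ w z      ≡⟨ cong (_+ δ w z) (flip-indeg as yv z) ⟩
    indeg O z + δ y z + δ w z       ≡⟨ swapʳ (indeg O z) (δ y z) (δ w z) ⟩
    indeg O z + δ w z + δ y z       ∎)
  where
  open ≡-Reasoning
  O₁ = flip O y v
  swapʳ : ∀ a b c → a + b + c ≡ a + c + b
  swapʳ a b c = trans (+-assoc a b c) (trans (cong (a +_) (+-comm b c)) (≡-sym (+-assoc a c b)))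
  keep : ∀ a b → a ∈ y ∷ xs → b ∈ y ∷ xs → O a b ≡ true → O₁ a b ≡ true
  keep a b i j h = trans (Flip.other as yv a b (λ e _ → v∉ (subst (_∈ y ∷ xs) e i))
                                               (λ _ e → v∉ (subst (_∈ y ∷ xs) e j))) h

remove : (Fin m → Bool) → Fin m → Fin m → Bool
remove Z x z = Z z ∧ not ⌊ z ≟ x ⌋

remove-⊆ : ∀ (Z : Fin m → Bool) x z → remove Z x z ≡ true → Z z ≡ true
remove-⊆ Z x z h with Z z
... | true = refl

remove-self : ∀ (Z : Fin m → Bool) x → remove Z x x ≡ false
remove-self Z x with x ≟ x | Z x
... | yes _ | true  = refl
... | yes _ | false = refl
... | no ne | _     = contradiction refl ne

remove-other : ∀ (Z : Fin m → Bool) {x z} → z ≢ x → remove Z x z ≡ Z z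
remove-other Z {x} {z} ne with z ≟ x | Z z
... | yes e | _     = contradiction e ne
... | no _  | true  = refl
... | no _  | false = refl

-- The vertices reachable from {w | in(w) < c(w)} form the complement of a set Z closed under
-- predecessors; on such a Z every in-degree is at least c.
record Closed {N} (O : Arcs N) (c : Fin N → ℕ) (v : Fin N) : Set where
  field
    Z     : Fin N → Bool
    v∈Z   : Z v ≡ true
    full  : ∀ z → Z z ≡ true → c z ≤ indeg O z
    preds : ∀ y z → Z z ≡ true → O y z ≡ true → Z y ≡ true

SlackPath : (O : Arcs N) (c : Fin N → ℕ) (Z : Fin N → Bool) → Fin N → Set
SlackPath O c Z x = ∃₂ λ w xs → indeg O w < c w × Path O w x xs × (∀ y → y ∈ x ∷ xs → Z y ≡ false)

-- Backwards formulation of reachability: `Z` holds the vertices not yet reached from a vertex with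
-- slack, and `k` bounds its size. An arc entering `Z` from outside reaches one more vertex. Known
-- paths lie outside `Z`, so appending that vertex keeps them simple.
search : (O : Arcs N) (c : Fin N → ℕ) (v : Fin N) → ∀ k (Z : Fin N → Bool) → count Z ≤ k →
         (∀ z → Z z ≡ true → c z ≤ indeg O z) →
         (∀ z → Z z ≡ false → SlackPath O c Z z) →
         (∃₂ λ w xs → indeg O w < c w × Path O w v xs) ⊎ Closed O c v
search O c v k Z le full paths with Z v in Zv
... | false with w , xs , sl , p , _ ← paths v Zv = inj₁ (w , xs , sl , p)
... | true with any? (λ z → any? (λ y → (Z z Bool.≟ true) ×-dec (O y z Bool.≟ true) ×-dec (Z y Bool.≟ false)))
...   | no none = inj₂ record { Z = Z ; v∈Z = Zv ; full = full ; preds = preds }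
  where
  preds : ∀ y z → Z z ≡ true → O y z ≡ true → Z y ≡ true
  preds y z Zz yz with Z y in Zy
  ... | true  = refl
  ... | false = ⊥-elim (none (z , y , Zz , yz , Zy))
...   | yes (x , y , Zx , yx , Zy) with k
...     | zero = contradiction (≤-trans (count>0 x Zx) le) λ ()
...     | suc k = search O c v k Z′
            (s≤s⁻¹ (≤-trans (≤-reflexive (≡-sym (count-insert x (remove-self Z x) Zx (λ j → remove-other Z)))) le))
            (λ z h → full z (remove-⊆ Z x z h)) paths′
  where
  Z′ = remove Z x
  off : ∀ z → Z z ≡ false → Z′ z ≡ false
  off z h rewrite h = refl
  paths′ : ∀ z → Z′ z ≡ false → SlackPath O c Z′ z
  paths′ z h with z ≟ x
  ... | no ne with w , xs , sl , p , out ← paths z (trans (≡-sym (Bool.∧-identityʳ (Z z))) h) =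
    w , xs , sl , p , λ u i → off u (out u i)
  ... | yes refl with w , xs , sl , p , out ← paths y Zy =
    w , y ∷ xs , sl , step yx (λ i → true≢false (trans (≡-sym Zx) (out z i))) p ,
    λ { u (here refl) → remove-self Z z ; u (there i) → off u (out u i) }

-- Double counting of the arcs with head in `Z`. By the in-degrees there are more than the sum of
-- `c` over `Z`, strictly because of `v`; but all tails lie in `Z` too, so the out-degrees allow at
-- most the sum of `b`, which is no larger.
closed-absurd : {O : Arcs N} {b c : Fin N → ℕ} {v : Fin N} → (∀ z → b z ≤ c z) →
                (∀ z → outdeg O z ≤ b z) → c v < indeg O v → Closed O c v → ⊥
closed-absurd {N} {O} {b} {c} {v} b≤c out≤ excess C = <-irrefl refl (begin-strict
  sum (λ z → if Z z then c z else 0)             <⟨ sum-mono-< (λ z → onZ z (full z)) v atv ⟩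
  sum (λ z → if Z z then indeg O z else 0)       ≡⟨ sum-cong-≗ (λ z → pull (Z z) (λ u → O u z)) ⟩
  sum (λ z → sum (λ u → 𝟙 (Z z ∧ O u z)))        ≡⟨ ∑-comm (λ z u → 𝟙 (Z z ∧ O u z)) ⟩
  sum (λ u → sum (λ z → 𝟙 (Z z ∧ O u z)))        ≤⟨ sum-mono (λ u → sum-mono (λ z → 𝟙-mono (back u z))) ⟩
  sum (λ u → sum (λ z → 𝟙 (Z u ∧ O u z)))        ≡⟨ sum-cong-≗ (λ u → pull (Z u) (λ z → O u z)) ⟨
  sum (λ u → if Z u then outdeg O u else 0)      ≤⟨ sum-mono (λ u → onZ u (λ _ → ≤-trans (out≤ u) (b≤c u))) ⟩
  sum (λ z → if Z z then c z else 0)             ∎)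
  where
  open ≤-Reasoning
  open Closed C
  onZ : ∀ z {x y} → (Z z ≡ true → x ≤ y) → (if Z z then x else 0) ≤ (if Z z then y else 0)
  onZ z h with Z z
  ... | true  = h refl
  ... | false = z≤n
  atv : (if Z v then c v else 0) < (if Z v then indeg O v else 0)
  atv rewrite v∈Z = excess
  pull : ∀ z (p : Fin N → Bool) → (if z then count p else 0) ≡ sum (λ u → 𝟙 (z ∧ p u))
  pull true  p = count≡sum p
  pull false p = ≡-sym (trans (sum-const N 0) (*-zeroʳ N))
  back : ∀ u z → Z z ∧ O u z ≡ true → Z u ∧ O u z ≡ true
  back u z h with Z z in Zz | O u z in uz
  ... | true | true rewrite preds u z Zz uz = refl

slackPath : (O : Arcs N) {b c : Fin N → ℕ} → (∀ z → b z ≤ c z) → (∀ z → outdeg O z ≤ b z) →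
            ∀ v → c v < indeg O v → ∃₂ λ w xs → indeg O w < c w × Path O w v xs
slackPath {N} O {b} {c} b≤c out≤ v excess = conclude (search O c v _ Z ≤-refl full paths)
  where
  Z : Fin N → Bool
  -- Vertices with slack start outside `Z`, each reached by its trivial path.
  Z z = not ⌊ indeg O z <? c z ⌋
  full : ∀ z → Z z ≡ true → c z ≤ indeg O z
  full z h with indeg O z <? c z
  ... | no nlt = ≮⇒≥ nlt
  paths : ∀ z → Z z ≡ false → SlackPath O c Z z
  paths z h with indeg O z <? c z in eq
  ... | yes lt = z , [] , lt , [_] , λ { y (here refl) → cong (not ∘ ⌊_⌋) eq }
  conclude : (∃₂ λ w xs → indeg O w < c w × Path O w v xs) ⊎ Closed O c v → _
  conclude (inj₁ p) = p
  conclude (inj₂ C) = ⊥-elim (closed-absurd b≤c out≤ excess C)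

record Balanced {N} (O : Arcs N) (b c : Fin N → ℕ) : Set where
  field
    arcs      : Arcs N
    reorients : Reorients O arcs
    out≤      : ∀ v → outdeg arcs v ≤ b v
    in≤       : ∀ v → indeg arcs v ≤ c v

-- While some in-degree exceeds `c`, a path from a vertex with slack to that vertex exists and is
-- reversed. The total excess drops strictly, which bounds the number of reversals.
balance : (O : Arcs N) {b c : Fin N → ℕ} → (∀ v → b v ≤ c v) → Asym O →
          (∀ v → outdeg O v ≤ b v) → (∀ v → indeg O v + outdeg O v ≤ b v + c v) → Balanced O b c
balance {N} O {b} {c} b≤c as out≤ deg≤ = go _ O (reorients-refl as) out≤ ≤-refl
  where
  go : ∀ k P → Reorients O P → (∀ v → outdeg P v ≤ b v) → sum (λ v → indeg P v ∸ c v) ≤ k → Balanced O b c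
  go k P r out≤ le with any? (λ v → c v <? indeg P v)
  ... | no none = record { arcs = P ; reorients = r ; out≤ = out≤ ; in≤ = λ v → ≮⇒≥ (λ lt → none (v , lt)) }
  ... | yes (v , excess) with w , xs , slack , p ← slackPath P b≤c out≤ v excess
    with P′ , r′ , eq ← flipPath (asym′ r) p = continue k le
    where
    v≢w : v ≢ w
    v≢w refl = <-asym excess slack
    in-v : suc (indeg P′ v) ≡ indeg P v
    in-v = trans (+-comm 1 _) (trans (cong (indeg P′ v +_) (≡-sym (δ-refl v)))
             (trans (eq v) (trans (cong (indeg P v +_) (δ-≢ (v≢w ∘ ≡-sym))) (+-identityʳ _))))
    in-other : ∀ z → z ≢ v → indeg P′ z ≡ indeg P z + δ w z
    in-other z ne = trans (≡-sym (+-identityʳ _))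
                      (trans (cong (indeg P′ z +_) (≡-sym (δ-≢ (ne ∘ ≡-sym)))) (eq z))
    deg-eq : ∀ z → indeg P′ z + outdeg P′ z ≡ indeg P z + outdeg P z
    deg-eq = degree-preserved (asym′ r) r′
    out′ : ∀ z → outdeg P′ z ≤ b z
    out′ z with z ≟ v
    -- The end `v` gains an outgoing arc, but its in-degree is still at least `c`, so the bound on
    -- the total degree leaves at most `b` for the out-degree.
    ... | yes refl = +-cancelˡ-≤ (c z) _ _ (begin
      c z + outdeg P′ z             ≤⟨ +-monoˡ-≤ _ (s≤s⁻¹ (≤-trans excess (≤-reflexive (≡-sym in-v)))) ⟩
      indeg P′ z + outdeg P′ z      ≡⟨ degree-preserved as (reorients-trans r r′) z ⟩
      indeg O z + outdeg O z        ≤⟨ deg≤ z ⟩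
      b z + c z                     ≡⟨ +-comm (b z) (c z) ⟩
      c z + b z                     ∎)
      where open ≤-Reasoning
    ... | no ne = +-cancelˡ-≤ (indeg P z) _ _ (begin
      indeg P z + outdeg P′ z       ≤⟨ +-monoˡ-≤ _ (≤-trans (m≤m+n _ (δ w z)) (≤-reflexive (≡-sym (in-other z ne)))) ⟩
      indeg P′ z + outdeg P′ z      ≡⟨ deg-eq z ⟩
      indeg P z + outdeg P z        ≤⟨ +-monoʳ-≤ (indeg P z) (out≤ z) ⟩
      indeg P z + b z               ∎)
      where open ≤-Reasoning
    mono : ∀ z → indeg P′ z ∸ c z ≤ indeg P z ∸ c z
    mono z with z ≟ v | z ≟ w
    ... | yes refl | _ = ∸-monoˡ-≤ (c z) (≤-trans (n≤1+n _) (≤-reflexive in-v))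
    -- The start `w` had slack, so its excess is still zero after it gains an arc.
    ... | no ne | yes refl = ≤-trans (≤-reflexive (m≤n⇒m∸n≡0 (≤-trans (≤-reflexive
                               (trans (in-other z ne) (trans (cong (indeg P z +_) (δ-refl z)) (+-comm _ 1)))) slack))) z≤n
    ... | no ne | no ne′ = ∸-monoˡ-≤ (c z) (≤-reflexive (trans (in-other z ne)
                             (trans (cong (indeg P z +_) (δ-≢ (ne′ ∘ ≡-sym))) (+-identityʳ _))))
    atv : indeg P′ v ∸ c v < indeg P v ∸ c v
    atv = ∸-monoˡ-< (≤-reflexive in-v) (s≤s⁻¹ (≤-trans excess (≤-reflexive (≡-sym in-v))))
    continue : ∀ k → sum (λ v → indeg P v ∸ c v) ≤ k → Balanced O b c
    continue zero    le = contradiction (≤-trans (sum-mono-< mono v atv) le) λ ()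
    continue (suc k) le = go k P′ (reorients-trans r r′) out′ (s≤s⁻¹ (≤-trans (sum-mono-< mono v atv) le))

-- Edge colouring of arcs by Kempe changes

count-++ : ∀ m {N} (p : Fin (m + N) → Bool) →
           count p ≡ count (λ i → p (i ↑ˡ N)) + count (λ j → p (m ↑ʳ j))
count-++ zero    p = refl
count-++ (suc m) p = trans (cong (𝟙 (p zero) +_) (count-++ m (p ∘ suc))) (≡-sym (+-assoc (𝟙 (p zero)) _ _))

count-splitAt : ∀ m {N} (g : Fin m ⊎ Fin N → Bool) →
                count (g ∘ splitAt m) ≡ count (g ∘ inj₁) + count (g ∘ inj₂)
count-splitAt m {N} g = trans (count-++ m (g ∘ splitAt m))
  (cong₂ _+_ (count-cong (λ i → cong g (splitAt-↑ˡ m i N))) (count-cong (λ j → cong g (splitAt-↑ʳ m N j))))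

isColour : ∀ {d} → Maybe (Fin d) → Fin d → Bool
isColour k i = ⌊ ≡-dec _≟_ k (just i) ⌋

isColour⁻ : ∀ {d} {k : Maybe (Fin d)} {i} → isColour k i ≡ true → k ≡ just i
isColour⁻ {k = k} {i} h with ≡-dec _≟_ k (just i)
... | yes e = e

isColour⁺ : ∀ {d} {k : Maybe (Fin d)} {i} → k ≡ just i → isColour k i ≡ true
isColour⁺ {k = k} {i} e with ≡-dec _≟_ k (just i)
... | yes _ = refl
... | no ne = contradiction e ne

-- If each of the `d` colours occurred at least `b` times, at least `d * b` elements would be
-- coloured. All coloured elements satisfy `q`, and the uncoloured `x₀` does as well, so `count q`
-- would exceed `d * b`.
missingColour : ∀ {d} (q : Fin m → Bool) (k : Fin m → Maybe (Fin d)) b →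
  (∀ x {i} → k x ≡ just i → q x ≡ true) → ∀ x → k x ≡ nothing → q x ≡ true →
  count q ≤ d * b → ∃ λ i → count (λ x → isColour (k x) i) < b
missingColour {m} {d} q k b sound x₀ kx₀ qx₀ le with any? (λ i → count (λ x → isColour (k x) i) <? b)
... | yes found = found
... | no none = contradiction le (<⇒≱ (begin-strict
  d * b                                          ≡⟨ sum-const d b ⟨
  sum {d} (λ _ → b)                              ≤⟨ sum-mono (λ i → ≮⇒≥ (λ lt → none (i , lt))) ⟩
  sum (λ i → count (λ x → isColour (k x) i))     ≡⟨ sum-cong-≗ (λ i → count≡sum (λ x → isColour (k x) i)) ⟩
  sum (λ i → sum (λ x → 𝟙 (isColour (k x) i)))   ≡⟨ ∑-comm (λ i x → 𝟙 (isColour (k x) i)) ⟩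
  sum (λ x → sum (λ i → 𝟙 (isColour (k x) i)))   ≡⟨ sum-cong-≗ (λ x → count≡sum (isColour (k x))) ⟨
  sum (λ x → count (isColour (k x)))             <⟨ sum-mono-< weak x₀ atx₀ ⟩
  sum (𝟙 ∘ q)                                    ≡⟨ count≡sum q ⟨
  count q                                        ∎))
  where
  open ≤-Reasoning
  colours : Maybe (Fin d) → ℕ
  colours k = count (isColour k)
  none-nothing : ∀ k → k ≡ nothing → colours k ≡ 0
  none-nothing k refl = count≡0 {p = isColour {d} nothing} absurd
    where
    absurd : ∀ i → isColour {d} nothing i ≡ true → ⊥
    absurd i ()
  weak : ∀ x → colours (k x) ≤ 𝟙 (q x)
  weak x with k x in eq
  ... | nothing = ≤-trans (≤-reflexive (none-nothing nothing refl)) z≤n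
  ... | just i rewrite sound x eq = count≤1 {p = isColour (just i)} λ a b ha hb →
    just-injective (trans (≡-sym (isColour⁻ {k = just i} ha)) (isColour⁻ {k = just i} hb))
  atx₀ : colours (k x₀) < 𝟙 (q x₀)
  atx₀ rewrite none-nothing (k x₀) kx₀ | qx₀ = s≤s z≤n

-- Partial colourings: `nothing` stands both for a pair that is no arc and for an arc without a
-- colour so far.
Colouring : ℕ → ℕ → Set
Colouring N d = Fin N → Fin N → Maybe (Fin d)

outCol inCol : ∀ {d} → Colouring N d → Fin d → Fin N → ℕ
outCol κ i u = count (λ w → isColour (κ u w) i)
inCol  κ i v = count (λ w → isColour (κ w v) i)

record Proper {N d} (O : Arcs N) (c : Fin N → ℕ) (κ : Colouring N d) : Set where
  field
    sound : ∀ u v {i} → κ u v ≡ just i → O u v ≡ true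
    out≤1 : ∀ i u → outCol κ i u ≤ 1
    in≤   : ∀ i v → inCol κ i v ≤ c v

assign : ∀ {d} → Colouring N d → Fin N → Fin N → Fin d → Colouring N d
assign κ u v i a b = if ⌊ a ≟ u ⌋ ∧ ⌊ b ≟ v ⌋ then just i else κ a b

module Assign {d} (κ : Colouring N d) {u v : Fin N} (i : Fin d) (fresh : κ u v ≡ nothing) where

  κ′ : Colouring N d
  κ′ = assign κ u v i

  at : κ′ u v ≡ just i
  at with u ≟ u | v ≟ v
  ... | yes _ | yes _ = refl
  ... | no ne | _     = contradiction refl ne
  ... | yes _ | no ne = contradiction refl ne

  away : ∀ a b → (a ≡ u → b ≡ v → ⊥) → κ′ a b ≡ κ a b
  away a b h with a ≟ u | b ≟ v
  ... | yes p | yes q = ⊥-elim (h p q)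
  ... | yes _ | no _  = refl
  ... | no _  | _     = refl

  split : ∀ a b → (a ≡ u × b ≡ v) ⊎ κ′ a b ≡ κ a b
  split a b with a ≟ u | b ≟ v
  ... | yes p | yes q = inj₁ (p , q)
  ... | yes _ | no _  = inj₂ refl
  ... | no _  | _     = inj₂ refl

  cong-colour : ∀ {k k′ : Maybe (Fin d)} j → k ≡ k′ → isColour k j ≡ isColour k′ j
  cong-colour j refl = refl

  nothing-false : isColour (κ u v) i ≡ false
  nothing-false rewrite fresh = refl

  out-same : ∀ a → outCol κ′ i a ≤ suc (outCol κ i a)
  out-same a = by (a ≟ u)
    where
    by : Dec (a ≡ u) → outCol κ′ i a ≤ suc (outCol κ i a)
    by (yes refl) = ≤-reflexive (count-insert {p = λ w → isColour (κ a w) i} {λ w → isColour (κ′ a w) i}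
      v nothing-false (isColour⁺ at)
      (λ w ne → cong-colour i (≡-sym (away a w (λ _ e → ne e)))))
    by (no ne) = ≤-trans (≤-reflexive (count-cong (λ w → cong-colour i (away a w (λ e _ → ne e))))) (n≤1+n _)

  in-same : ∀ b → b ≡ v → inCol κ′ i b ≡ suc (inCol κ i b)
  in-same b refl = count-insert {p = λ w → isColour (κ w b) i} {λ w → isColour (κ′ w b) i}
    u nothing-false (isColour⁺ at)
    (λ w ne → cong-colour i (≡-sym (away w b (λ e _ → ne e))))

  in-away : ∀ b → b ≢ v → inCol κ′ i b ≡ inCol κ i b
  in-away b ne = count-cong (λ w → cong-colour i (away w b (λ _ e → ne e)))

  other : ∀ {j} → i ≢ j → ∀ a b → isColour (κ′ a b) j ≡ true → isColour (κ a b) j ≡ true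
  other {j} ne a b h with split a b
  ... | inj₂ e = trans (cong-colour j (≡-sym e)) h
  ... | inj₁ (refl , refl) = contradiction (just-injective (trans (≡-sym at) (isColour⁻ h))) ne

-- Only being coloured is preserved, not the colour itself, because a Kempe change recolours arcs.
Extends : ∀ {d} (κ κ′ : Colouring N d) → Set
Extends κ κ′ = ∀ a b {i} → κ a b ≡ just i → ∃ λ j → κ′ a b ≡ just j

bip′ : (A B : Arcs N) → Fin N ⊎ Fin N → Fin N ⊎ Fin N → Bool
bip′ A B (inj₁ a) (inj₂ b) = A a b
bip′ A B (inj₂ b) (inj₁ a) = B a b
bip′ A B _        _        = false

-- The bipartite double cover, with the arcs of A running from left to right and those of B from right to left.
bip : (A B : Arcs N) → Arcs (N + N)
bip {N} A B x y = bip′ A B (splitAt N x) (splitAt N y)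

count-false : ∀ m → count {m} (λ _ → false) ≡ 0
count-false m = count≡0 {p = λ (_ : Fin m) → false} (λ _ ())

bip-out : (A B : Arcs N) → ∀ x → count (λ y → bip′ A B x (splitAt N y)) ≡
          (case x of λ { (inj₁ a) → count (A a) ; (inj₂ b) → count (λ a → B a b) })
bip-out {N} A B (inj₁ a) = trans (count-splitAt N (bip′ A B (inj₁ a))) (cong (_+ count (A a)) (count-false N))
bip-out {N} A B (inj₂ b) = trans (count-splitAt N (bip′ A B (inj₂ b)))
  (trans (cong (count (λ a → B a b) +_) (count-false N)) (+-identityʳ _))

bip-in : (A B : Arcs N) → ∀ y → count (λ x → bip′ A B (splitAt N x) y) ≡
         (case y of λ { (inj₁ a) → count (B a) ; (inj₂ b) → count (λ a → A a b) })
bip-in {N} A B (inj₁ a) = trans (count-splitAt N (λ x → bip′ A B x (inj₁ a))) (cong (_+ count (B a)) (count-false N))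
bip-in {N} A B (inj₂ b) = trans (count-splitAt N (λ x → bip′ A B x (inj₂ b)))
  (trans (cong (count (λ a → A a b) +_) (count-false N)) (+-identityʳ _))

bip-asym : {A B : Arcs N} → (∀ a b → A a b ≡ true → B a b ≡ true → ⊥) → Asym (bip A B)
bip-asym {N} disj x y p q with splitAt N x | splitAt N y
... | inj₁ a | inj₂ b = disj a b p q
... | inj₂ b | inj₁ a = disj a b q p

-- A new split of the union of two colour classes: `A′` is one class, and what it leaves of the
-- union is the other.
record Recoloured {N} (A B : Arcs N) (c : Fin N → ℕ) : Set where
  field
    A′     : Arcs N
    A-out  : ∀ a → count (λ b → A′ a b) ≤ 1
    A-in   : ∀ b → count (λ a → A′ a b) ≤ c b
    B-out  : ∀ a → count (λ b → (A a b ∨ B a b) ∧ not (A′ a b)) ≤ 1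
    B-in   : ∀ b → count (λ a → (A a b ∨ B a b) ∧ not (A′ a b)) ≤ c b

-- In the double cover, the in- and out-degree of a left vertex are its out-degrees in `B` and `A`,
-- and those of a right vertex its in-degrees in `A` and `B`. Balancing with capacity 1 on the left
-- and `c` on the right therefore repairs the in-degrees of `A`; the arcs then running from left to
-- right form `A′`.
recolour : {A B : Arcs N} {c : Fin N → ℕ} → (∀ a b → A a b ≡ true → B a b ≡ true → ⊥) →
           (∀ a → count (λ b → A a b) ≤ 1) → (∀ a → count (λ b → B a b) ≤ 1) →
           (∀ b → count (λ a → B a b) ≤ c b) →
           (∀ b → count (λ a → A a b) + count (λ a → B a b) ≤ c b + c b) → Recoloured A B c
recolour {N} {A} {B} {c} disj Aout Bout Bin both = record
  { A′    = λ a b → P (a ↑ˡ N) (N ↑ʳ b)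
  ; A-out = λ a → ≤-trans (sumʳ (P (a ↑ˡ N))) (subst (outdeg P (a ↑ˡ N) ≤_) (capˡ a) (out≤ (a ↑ˡ N)))
  ; A-in  = λ b → ≤-trans (sumˡ (λ x → P x (N ↑ʳ b))) (subst (indeg P (N ↑ʳ b) ≤_) (capʳ b) (in≤ (N ↑ʳ b)))
  ; B-out = λ a → ≤-trans (count-mono (λ b → reverse a b))
                    (≤-trans (sumʳ (λ x → P x (a ↑ˡ N))) (subst (indeg P (a ↑ˡ N) ≤_) (capˡ a) (in≤ (a ↑ˡ N))))
  ; B-in  = λ b → ≤-trans (count-mono (λ a → reverse a b))
                    (≤-trans (sumˡ (P (N ↑ʳ b))) (subst (outdeg P (N ↑ʳ b) ≤_) (capʳ b) (out≤ (N ↑ʳ b))))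
  }
  where
  cap′ : Fin N ⊎ Fin N → ℕ
  cap′ (inj₁ _) = 1
  cap′ (inj₂ b) = c b
  cap : Fin (N + N) → ℕ
  cap = cap′ ∘ splitAt N
  out₀ : ∀ x → outdeg (bip A B) x ≤ cap x
  out₀ x with splitAt N x
  ... | inj₁ a = ≤-trans (≤-reflexive (bip-out A B (inj₁ a))) (Aout a)
  ... | inj₂ b = ≤-trans (≤-reflexive (bip-out A B (inj₂ b))) (Bin b)
  deg₀ : ∀ x → indeg (bip A B) x + outdeg (bip A B) x ≤ cap x + cap x
  deg₀ x with splitAt N x
  ... | inj₁ a = ≤-trans (≤-reflexive (cong₂ _+_ (bip-in A B (inj₁ a)) (bip-out A B (inj₁ a))))
                         (+-mono-≤ (Bout a) (Aout a))
  ... | inj₂ b = ≤-trans (≤-reflexive (cong₂ _+_ (bip-in A B (inj₂ b)) (bip-out A B (inj₂ b)))) (both b)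
  balanced : Balanced (bip A B) cap cap
  balanced = balance (bip A B) (λ _ → ≤-refl) (bip-asym disj) out₀ deg₀
  open Balanced balanced renaming (arcs to P)
  capˡ : ∀ a → cap (a ↑ˡ N) ≡ 1
  capˡ a = cong cap′ (splitAt-↑ˡ N a N)
  capʳ : ∀ b → cap (N ↑ʳ b) ≡ c b
  capʳ b = cong cap′ (splitAt-↑ʳ N N b)
  sumˡ : ∀ p → count (λ a → p (a ↑ˡ N)) ≤ count p
  sumˡ p = ≤-trans (m≤m+n _ _) (≤-reflexive (≡-sym (count-++ N p)))
  sumʳ : ∀ p → count (λ b → p (N ↑ʳ b)) ≤ count p
  sumʳ p = ≤-trans (m≤n+m _ (count (λ a → p (a ↑ˡ N)))) (≤-reflexive (≡-sym (count-++ N p)))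
  -- Balancing only reverses arcs, so an arc of the union that does not run from left to right runs
  -- from right to left.
  reverse : ∀ a b → (A a b ∨ B a b) ∧ not (P (a ↑ˡ N) (N ↑ʳ b)) ≡ true → P (N ↑ʳ b) (a ↑ˡ N) ≡ true
  reverse a b h with P (a ↑ˡ N) (N ↑ʳ b) in eq
  ... | true  = contradiction (≡-sym (trans (≡-sym (Bool.∧-zeroʳ (A a b ∨ B a b))) h)) true≢false
  ... | false = case kept (∨-true (trans (≡-sym (Bool.∧-identityʳ (A a b ∨ B a b))) h)) of λ
      { (inj₁ k) → contradiction (trans (≡-sym k) eq) true≢false ; (inj₂ k) → k }
    where
    AB : bip A B (a ↑ˡ N) (N ↑ʳ b) ≡ A a b
    AB rewrite splitAt-↑ˡ N a N | splitAt-↑ʳ N N b = refl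
    BA : bip A B (N ↑ʳ b) (a ↑ˡ N) ≡ B a b
    BA rewrite splitAt-↑ˡ N a N | splitAt-↑ʳ N N b = refl
    kept : A a b ≡ true ⊎ B a b ≡ true →
           P (a ↑ˡ N) (N ↑ʳ b) ≡ true ⊎ P (N ↑ʳ b) (a ↑ˡ N) ≡ true
    kept (inj₁ k) = to reorients (trans AB k)
    kept (inj₂ k) = swap⊎ (to reorients (trans BA k))

module Insert {d} {O : Arcs N} {c : Fin N → ℕ} (1≤c : ∀ v → 1 ≤ c v)
  {κ : Colouring N d} (proper : Proper O c κ) {u v : Fin N} (uv : O u v ≡ true) (fresh : κ u v ≡ nothing)
  (α : Fin d) (α-free : outCol κ α u < 1) where

  open Proper proper
  open Assign κ α fresh

  Result : Set
  Result = ∃ λ κ″ → Proper O c κ″ × Extends κ κ″ × ∃ λ j → κ″ u v ≡ just j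

  extends : Extends κ κ′
  extends a b h with split a b
  ... | inj₁ (refl , refl) = α , at
  ... | inj₂ e             = _ , trans e h

  sound′ : ∀ a b {i} → κ′ a b ≡ just i → O a b ≡ true
  sound′ a b h with split a b
  ... | inj₁ (refl , refl) = uv
  ... | inj₂ e             = sound a b (trans (≡-sym e) h)

  out′ : ∀ a → outCol κ′ α a ≤ 1
  out′ a = by (a ≟ u)
    where
    by : Dec (a ≡ u) → outCol κ′ α a ≤ 1
    by (yes refl) = ≤-trans (out-same a) α-free
    by (no ne) = ≤-trans (≤-reflexive (count-cong (λ w → cong-colour α (away a w (λ e _ → ne e))))) (out≤1 α a)

  direct : inCol κ α v < c v → Result
  direct lt = κ′ , record { sound = sound′ ; out≤1 = outs ; in≤ = ins } , extends , α , at
    where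
    outs : ∀ i a → outCol κ′ i a ≤ 1
    outs i a = by (α ≟ i)
      where
      by : Dec (α ≡ i) → outCol κ′ i a ≤ 1
      by (yes refl) = out′ a
      by (no ne)    = ≤-trans (count-mono (λ b → other ne a b)) (out≤1 i a)
    ins : ∀ i b → inCol κ′ i b ≤ c b
    ins i b = by (α ≟ i) (b ≟ v)
      where
      by : Dec (α ≡ i) → Dec (b ≡ v) → inCol κ′ i b ≤ c b
      by (yes refl) (yes refl) = ≤-trans (≤-reflexive (in-same b refl)) lt
      by (yes refl) (no ne)    = ≤-trans (≤-reflexive (in-away b ne)) (in≤ i b)
      by (no ne)    _          = ≤-trans (count-mono (λ a → other ne a b)) (in≤ i b)

  -- Colour `α` is free at the tail `u`, while `β` has room at the head `v`. The new arc gets `α`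
  -- although this may overload `v`, and the union of the classes `α` and `β` is then split anew.
  module Kempe (β : Fin d) (α≢β : α ≢ β) (β-free : inCol κ β v < c v) where

    A B : Arcs N
    A a b = isColour (κ′ a b) α
    B a b = isColour (κ′ a b) β

    B-in₀ : ∀ b → inCol κ′ β b ≤ inCol κ β b
    B-in₀ b = count-mono (λ a → other α≢β a b)

    recoloured : Recoloured A B c
    recoloured = recolour
      (λ a b p q → α≢β (just-injective (trans (≡-sym (isColour⁻ p)) (isColour⁻ q))))
      out′ (λ a → ≤-trans (count-mono (λ b → other α≢β a b)) (out≤1 β a))
      (λ b → ≤-trans (B-in₀ b) (in≤ β b)) (λ b → both b (b ≟ v))
      where
      both : ∀ b → Dec (b ≡ v) → inCol κ′ α b + inCol κ′ β b ≤ c b + c b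
      both b (yes refl) = begin
        inCol κ′ α b + inCol κ′ β b      ≤⟨ +-mono-≤ (≤-reflexive (in-same b refl)) (B-in₀ b) ⟩
        suc (inCol κ α b) + inCol κ β b  ≡⟨ +-suc (inCol κ α b) (inCol κ β b) ⟨
        -- The room left for `β` at `v` pays for the one additional arc of colour `α`.
        inCol κ α b + suc (inCol κ β b)  ≤⟨ +-mono-≤ (in≤ α b) β-free ⟩
        c b + c b                        ∎
        where open ≤-Reasoning
      both b (no ne) = +-mono-≤ (≤-trans (≤-reflexive (in-away b ne)) (in≤ α b)) (≤-trans (B-in₀ b) (in≤ β b))

    module Merge (R : Recoloured A B c) where

      open Recoloured R

      κ″ : Colouring N d
      κ″ a b = if A a b ∨ B a b then just (if A′ a b then α else β) else κ′ a b

      data View (a b : Fin N) : Set where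
        isα    : ∀ {i} → κ′ a b ≡ just i → A′ a b ≡ true → κ″ a b ≡ just α → View a b
        isβ    : ∀ {i} → κ′ a b ≡ just i → (A a b ∨ B a b) ∧ not (A′ a b) ≡ true → κ″ a b ≡ just β → View a b
        isElse : A a b ≡ false → B a b ≡ false → κ″ a b ≡ κ′ a b → View a b

      κ″-≡ : ∀ a b {x y} → A a b ∨ B a b ≡ x → A′ a b ≡ y →
             κ″ a b ≡ (if x then just (if y then α else β) else κ′ a b)
      κ″-≡ a b refl refl = refl

      view : ∀ a b → View a b
      view a b = by (A a b) (B a b) (A′ a b) refl refl refl
        where
        by : ∀ x y z → A a b ≡ x → B a b ≡ y → A′ a b ≡ z → View a b
        by true  y     true  eA eB eA′ = isα (isColour⁻ eA) eA′ (κ″-≡ a b (cong₂ _∨_ eA eB) eA′)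
        by true  y     false eA eB eA′ = isβ (isColour⁻ eA) (cong₂ _∧_ (cong₂ _∨_ eA eB) (cong not eA′))
                                             (κ″-≡ a b (cong₂ _∨_ eA eB) eA′)
        by false true  true  eA eB eA′ = isα (isColour⁻ eB) eA′ (κ″-≡ a b (cong₂ _∨_ eA eB) eA′)
        by false true  false eA eB eA′ = isβ (isColour⁻ eB) (cong₂ _∧_ (cong₂ _∨_ eA eB) (cong not eA′))
                                             (κ″-≡ a b (cong₂ _∨_ eA eB) eA′)
        by false false _     eA eB eA′ = isElse eA eB (κ″-≡ a b (cong₂ _∨_ eA eB) eA′)

      result : Result
      result = κ″ , record { sound = sound″ ; out≤1 = outs ; in≤ = ins } , ext , new
        where
        sound″ : ∀ a b {i} → κ″ a b ≡ just i → O a b ≡ true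
        sound″ a b h with view a b
        ... | isα e _ _    = sound′ a b e
        ... | isβ e _ _    = sound′ a b e
        ... | isElse _ _ e = sound′ a b (trans (≡-sym e) h)

        keep : ∀ a b {i} → κ′ a b ≡ just i → ∃ λ j → κ″ a b ≡ just j
        keep a b h with view a b
        ... | isα _ _ e    = α , e
        ... | isβ _ _ e    = β , e
        ... | isElse _ _ e = _ , trans e h

        ext : Extends κ κ″
        ext a b h = keep a b (proj₂ (extends a b h))

        new : ∃ λ j → κ″ u v ≡ just j
        new = keep u v at

        class-α : ∀ a b → isColour (κ″ a b) α ≡ true → A′ a b ≡ true
        class-α a b h with view a b
        ... | isα _ p _     = p
        ... | isβ _ _ e     = contradiction (just-injective (trans (≡-sym (isColour⁻ h)) e)) α≢β
        ... | isElse nA _ e = contradiction (trans (≡-sym (trans (cong-colour α (≡-sym e)) h)) nA) true≢false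

        class-β : ∀ a b → isColour (κ″ a b) β ≡ true → (A a b ∨ B a b) ∧ not (A′ a b) ≡ true
        class-β a b h with view a b
        ... | isα _ _ e     = contradiction (just-injective (trans (≡-sym e) (isColour⁻ h))) α≢β
        ... | isβ _ p _     = p
        ... | isElse _ nB e = contradiction (trans (≡-sym (trans (cong-colour β (≡-sym e)) h)) nB) true≢false

        class-else : ∀ {i} → α ≢ i → β ≢ i → ∀ a b → isColour (κ″ a b) i ≡ true → isColour (κ a b) i ≡ true
        class-else {i} α≢i β≢i a b h with view a b
        ... | isα _ _ e    = contradiction (just-injective (trans (≡-sym e) (isColour⁻ h))) α≢i
        ... | isβ _ _ e    = contradiction (just-injective (trans (≡-sym e) (isColour⁻ h))) β≢i
        ... | isElse _ _ e = other α≢i a b (trans (cong-colour i (≡-sym e)) h)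

        outs : ∀ i a → outCol κ″ i a ≤ 1
        outs i a = by (α ≟ i) (β ≟ i)
          where
          by : Dec (α ≡ i) → Dec (β ≡ i) → outCol κ″ i a ≤ 1
          by (yes refl) _          = ≤-trans (count-mono (class-α a)) (A-out a)
          by (no _)     (yes refl) = ≤-trans (count-mono (class-β a)) (B-out a)
          by (no p)     (no q)     = ≤-trans (count-mono (class-else p q a)) (out≤1 i a)

        ins : ∀ i b → inCol κ″ i b ≤ c b
        ins i b = by (α ≟ i) (β ≟ i)
          where
          by : Dec (α ≡ i) → Dec (β ≡ i) → inCol κ″ i b ≤ c b
          by (yes refl) _          = ≤-trans (count-mono (λ a → class-α a b)) (A-in b)
          by (no _)     (yes refl) = ≤-trans (count-mono (λ a → class-β a b)) (B-in b)
          by (no p)     (no q)     = ≤-trans (count-mono (λ a → class-else p q a b)) (in≤ i b)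

    recoloured-result : Result
    recoloured-result = Merge.result recoloured

record ArcColouring {N} (O : Arcs N) (d : ℕ) (c : Fin N → ℕ) : Set where
  field
    κ        : Colouring N d
    proper   : Proper O c κ
    complete : ∀ u v → O u v ≡ true → ∃ λ i → κ u v ≡ just i

-- Arcs are coloured one by one. As the current arc has no colour yet, some colour is absent among
-- the arcs leaving its tail, and some colour occurs fewer than `c v` times among those entering its
-- head. If the two agree it is used directly, otherwise after a Kempe change.
arcColouring : (O : Arcs N) (d : ℕ) {c : Fin N → ℕ} → (∀ v → 1 ≤ c v) →
               (∀ v → outdeg O v ≤ d) → (∀ v → indeg O v ≤ d * c v) → ArcColouring O d c
arcColouring {N} O d {c} 1≤c out≤ in≤dc =
  let κ , proper , complete = go (cartesianProduct (allFin N) (allFin N)) in record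
  { κ = κ ; proper = proper
  ; complete = λ u v → complete u v (∈-cartesianProduct⁺ (∈-allFin u) (∈-allFin v)) }
  where
  insert : (κ : Colouring N d) → Proper O c κ → ∀ u v → O u v ≡ true → κ u v ≡ nothing →
           ∃ λ κ″ → Proper O c κ″ × Extends κ κ″ × ∃ λ j → κ″ u v ≡ just j
  insert κ proper u v uv fresh
    with α , α-free ← missingColour (O u) (κ u) 1 (Proper.sound proper u) v fresh uv
                        (≤-trans (out≤ u) (≤-reflexive (≡-sym (*-identityʳ d))))
       | β , β-free ← missingColour (λ a → O a v) (λ a → κ a v) (c v) (λ a → Proper.sound proper a v) u fresh uv
                        (in≤dc v)
    with α ≟ β
  ... | yes refl = Insert.direct 1≤c proper uv fresh α α-free β-free
  ... | no α≢β   = Insert.Kempe.recoloured-result 1≤c proper uv fresh α α-free β α≢β β-free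

  go : ∀ ps → ∃ λ κ → Proper O c κ × (∀ u v → (u , v) ∈ ps → O u v ≡ true → ∃ λ i → κ u v ≡ just i)
  go [] = (λ _ _ → nothing) , record
    { sound = λ _ _ () ; out≤1 = λ i u → ≤-trans (≤-reflexive (count-false N)) z≤n
    ; in≤ = λ i v → ≤-trans (≤-reflexive (count-false N)) z≤n } , λ _ _ ()
  go ((u , v) ∷ ps) with go ps
  ... | κ , proper , done with O u v in uv | κ u v in fresh
  ...   | false | _ = κ , proper , λ { a b (here refl) h → contradiction (trans (≡-sym h) uv) true≢false
                                     ; a b (there i) h → done a b i h }
  ...   | true | just i = κ , proper , λ { a b (here refl) h → i , fresh ; a b (there i) h → done a b i h }
  ...   | true | nothing with κ″ , proper″ , ext , new ← insert κ proper u v uv fresh =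
    κ″ , proper″ , λ { a b (here refl) _ → new ; a b (there i) h → ext a b (proj₂ (done a b i h)) }

-- Orienting forests

-- A repetition before the closing position yields a shorter closed subwalk, and `bound` limits this
-- descent. Without repetition the walk is a cycle: length 1 would be a loop, and length 2 is
-- excluded because the walk never turns back. The bound on `ℓ` is what is later played against the
-- girth.
closedWalk⇒cycle : (G : Graph) (P : Fin (n G) → Fin (n G) → Set) (x : ℕ → Fin (n G)) →
  (∀ k → adj G (x k) (x (suc k)) ≡ true) → (∀ k → P (x k) (x (suc k))) → (∀ k → x k ≢ x (suc (suc k))) →
  ∀ i g → 0 < g → x (i + g) ≡ x i → ∃ λ ℓ → ℓ ≤ g × CycleIn G P ℓ
closedWalk⇒cycle G P x edge P-edge turn i g = go g i g ≤-refl
  where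
  go : ∀ bound i g → g ≤ bound → 0 < g → x (i + g) ≡ x i → ∃ λ ℓ → ℓ ≤ g × CycleIn G P ℓ
  go zero i g g≤ 0<g _ = contradiction (≤-trans 0<g g≤) λ ()
  go (suc bound) i g g≤ 0<g closes
    with any? {n = g} (λ a → any? {n = g} (λ b → (toℕ a <? toℕ b) ×-dec (x (i + toℕ a) ≟ x (i + toℕ b))))
  ... | yes (a , b , a<b , eq) =
    let ℓ , ℓ≤ , C = go bound (i + toℕ a) (toℕ b ∸ toℕ a) (s≤s⁻¹ (≤-trans gap< g≤)) (m<n⇒0<n∸m a<b)
                       (trans (cong x shift) (≡-sym eq))
    in ℓ , ≤-trans ℓ≤ (<⇒≤ gap<) , C
    where
    gap< : toℕ b ∸ toℕ a < g
    gap< = ≤-<-trans (m∸n≤m (toℕ b) (toℕ a)) (toℕ<n b)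
    shift : i + toℕ a + (toℕ b ∸ toℕ a) ≡ i + toℕ b
    shift = trans (+-assoc i _ _) (cong (i +_) (m+[n∸m]≡n (<⇒≤ a<b)))
  ... | no none = g , ≤-refl , record
    { len≥3 = len g 0<g closes
    ; vs    = λ a → x (i + toℕ a)
    ; inj   = inj
    ; edge  = λ a b nx → subst (λ y → adj G (x (i + toℕ a)) y ≡ true) (≡-sym (next a b nx)) (edge _)
    ; prop  = λ a b nx → subst (P (x (i + toℕ a))) (≡-sym (next a b nx)) (P-edge _) }
    where
    len : ∀ g → 0 < g → x (i + g) ≡ x i → 3 ≤ g
    len 1 _ eq = contradiction (trans (≡-sym (subst (λ y → adj G (x i) y ≡ true)
      (trans (cong x (+-comm 1 i)) eq) (edge i))) (irrefl G (x i))) true≢false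
    len 2 _ eq = contradiction (trans (≡-sym eq) (cong x (+-comm i 2))) (turn i)
    len (suc (suc (suc g))) _ _ = s≤s (s≤s (s≤s z≤n))
    inj : ∀ {a b : Fin g} → x (i + toℕ a) ≡ x (i + toℕ b) → a ≡ b
    inj {a} {b} eq with <-cmp (toℕ a) (toℕ b)
    ... | tri< lt _ _ = ⊥-elim (none (a , b , lt , eq))
    ... | tri≈ _ e _  = toℕ-injective e
    ... | tri> _ _ gt = ⊥-elim (none (b , a , gt , ≡-sym eq))
    next : ∀ (a b : Fin g) → CycNext a b → x (i + toℕ b) ≡ x (suc (i + toℕ a))
    next a b (inj₁ e) = cong x (trans (cong (i +_) (≡-sym e)) (+-suc i _))
    next a b (inj₂ (e , e₀)) = trans (cong x (trans (cong (i +_) e₀) (+-identityʳ i)))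
      (trans (≡-sym closes) (cong x (trans (cong (i +_) (≡-sym e)) (+-suc i _))))

Acyclic : Graph → Set
Acyclic G = ∀ ℓ → ¬ CycleIn G (λ _ _ → ⊤) ℓ

record TwoNeighbours (G : Graph) (X : Fin (n G) → Bool) (v : Fin (n G)) : Set where
  constructor two
  field
    {w₁ w₂} : Fin (n G)
    w₁≢w₂   : w₁ ≢ w₂
    X₁      : X w₁ ≡ true
    X₂      : X w₂ ≡ true
    adj₁    : adj G v w₁ ≡ true
    adj₂    : adj G v w₂ ≡ true

-- With two neighbours in `X` available, a walk can always go on to one other than the vertex it
-- came from. By pigeonhole it revisits a vertex, and a closed walk without turning back contains a
-- cycle.
branching⇒cyclic : (G : Graph) (X : Fin (n G) → Bool) → (∀ v → X v ≡ true → TwoNeighbours G X v) →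
                   ∀ v → X v ≡ true → ¬ Acyclic G
branching⇒cyclic G X branch v Xv acyclic =
  let i , j , i<j , eq = pigeonhole (n<1+n (n G)) (λ k → x (toℕ k))
      ℓ , _ , C = closedWalk⇒cycle G (λ _ _ → ⊤) x (λ k → Arc.edge (walk k)) (λ _ → tt)
                    (λ k e → proj₂ (next (walk k)) (≡-sym e))
                    (toℕ i) (toℕ j ∸ toℕ i) (m<n⇒0<n∸m i<j)
                    (trans (cong x (m+[n∸m]≡n (<⇒≤ i<j))) (≡-sym eq))
  in acyclic ℓ C
  where
  record Arc : Set where
    constructor arc
    field
      {from to} : Fin (n G)
      X-to      : X to ≡ true
      edge      : adj G from to ≡ true
  next : (e : Arc) → Σ (Σ (Fin (n G)) λ w → X w ≡ true × adj G (Arc.to e) w ≡ true) λ w → proj₁ w ≢ Arc.from e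
  next e with branch (Arc.to e) (Arc.X-to e)
  ... | two {w₁} {w₂} ne X₁ X₂ a₁ a₂ with w₁ ≟ Arc.from e
  ...   | no w₁≢u  = (w₁ , X₁ , a₁) , w₁≢u
  ...   | yes refl = (w₂ , X₂ , a₂) , ne ∘ ≡-sym
  advance : Arc → Arc
  advance e = let (w , Xw , a) , _ = next e in arc Xw a
  walk : ℕ → Arc
  walk zero    = let two _ X₁ _ a₁ _ = branch v Xv in arc X₁ a₁
  walk (suc k) = advance (walk k)
  x : ℕ → Fin (n G)
  x k = Arc.from (walk k)

record ForestOrientation (G : Graph) (X : Fin (n G) → Bool) : Set where
  field
    O      : Arcs (n G)
    as     : Asym O
    unique : ∀ u w w′ → O u w ≡ true → O u w′ ≡ true → w ≡ w′
    inX    : ∀ u w → O u w ≡ true → X u ≡ true × X w ≡ true × adj G u w ≡ true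
    covers : ∀ u w → X u ≡ true → X w ≡ true → adj G u w ≡ true → O u w ≡ true ⊎ O w u ≡ true

∧-true : ∀ {b c} → b ∧ c ≡ true → b ≡ true × c ≡ true
∧-true {true} {true} refl = refl , refl

-- A vertex with at most one neighbour in `X` is removed, the rest is oriented, and the edge at that
-- vertex, if any, is directed away from it. Every vertex thus has at most one outgoing arc.
orientForest : (G : Graph) → Acyclic G → ∀ k X → count X ≤ k → ForestOrientation G X
orientForest G acyclic k X le
  with any? (λ v → (X v Bool.≟ true) ×-dec ¬? (any? λ w₁ → any? λ w₂ →
         ¬? (w₁ ≟ w₂) ×-dec (X w₁ Bool.≟ true) ×-dec (X w₂ Bool.≟ true) ×-dec
         (adj G v w₁ Bool.≟ true) ×-dec (adj G v w₂ Bool.≟ true)))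
-- Here `X` is empty, since otherwise it would contain a cycle; the empty arc set covers everything.
... | no noLeaf = record
  { O = λ _ _ → false ; as = λ _ _ () ; unique = λ _ _ _ () ; inX = λ _ _ ()
  ; covers = λ u w Xu → ⊥-elim (branching⇒cyclic G X branch u Xu acyclic) }
  where
  branch : ∀ v → X v ≡ true → TwoNeighbours G X v
  branch v Xv with any? (λ w₁ → any? λ w₂ →
         ¬? (w₁ ≟ w₂) ×-dec (X w₁ Bool.≟ true) ×-dec (X w₂ Bool.≟ true) ×-dec
         (adj G v w₁ Bool.≟ true) ×-dec (adj G v w₂ Bool.≟ true))
  ... | yes (_ , _ , ne , X₁ , X₂ , a₁ , a₂) = two ne X₁ X₂ a₁ a₂
  ... | no none = ⊥-elim (noLeaf (v , Xv , none))
... | yes (v , Xv , leaf) with k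
...   | zero  = contradiction (≤-trans (count>0 v Xv) le) λ ()
...   | suc k = record { O = O′ ; as = as′ ; unique = unique′ ; inX = inX′ ; covers = covers′ }
  where
  X′ = remove X v
  open ForestOrientation (orientForest G acyclic k X′ (s≤s⁻¹ (≤-trans (≤-reflexive
    (≡-sym (count-insert v (remove-self X v) Xv (λ j → remove-other X)))) le)))
  new : Fin (n G) → Fin (n G) → Bool
  new u w = ⌊ u ≟ v ⌋ ∧ X w ∧ adj G v w
  O′ : Arcs (n G)
  O′ u w = O u w ∨ new u w
  new⁻ : ∀ u w → new u w ≡ true → u ≡ v × X w ≡ true × adj G v w ≡ true
  new⁻ u w h with u ≟ v
  ... | yes e = e , ∧-true h
  new⁺ : ∀ w → X w ≡ true → adj G v w ≡ true → new v w ≡ true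
  new⁺ w Xw a with v ≟ v
  ... | yes _ rewrite Xw = a
  ... | no ne = contradiction refl ne
  X′v : ∀ {b} {A : Set} → b ≡ v → X′ b ≡ true → A
  X′v refl h = contradiction (trans (≡-sym h) (remove-self X v)) true≢false
  as′ : Asym O′
  as′ u w p q with ∨-true {O u w} p | ∨-true {O w u} q
  ... | inj₁ p | inj₁ q = as u w p q
  ... | inj₁ p | inj₂ q = X′v (proj₁ (new⁻ w u q)) (proj₁ (proj₂ (inX u w p)))
  ... | inj₂ p | inj₁ q = X′v (proj₁ (new⁻ u w p)) (proj₁ (proj₂ (inX w u q)))
  ... | inj₂ p | inj₂ q with new⁻ u w p | new⁻ w u q
  ...   | refl , _ , a | refl , _ = true≢false (trans (≡-sym a) (irrefl G u))
  unique′ : ∀ u w w′ → O′ u w ≡ true → O′ u w′ ≡ true → w ≡ w′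
  unique′ u w w′ p q with ∨-true {O u w} p | ∨-true {O u w′} q
  ... | inj₁ p | inj₁ q = unique u w w′ p q
  ... | inj₁ p | inj₂ q = X′v (proj₁ (new⁻ u w′ q)) (proj₁ (inX u w p))
  ... | inj₂ p | inj₁ q = X′v (proj₁ (new⁻ u w p)) (proj₁ (inX u w′ q))
  ... | inj₂ p | inj₂ q with new⁻ u w p | new⁻ u w′ q | w ≟ w′
  ...   | _ | _ | yes e = e
  ...   | refl , Xw , a | _ , Xw′ , a′ | no ne = ⊥-elim (leaf (w , w′ , ne , Xw , Xw′ , a , a′))
  inX′ : ∀ u w → O′ u w ≡ true → X u ≡ true × X w ≡ true × adj G u w ≡ true
  inX′ u w p with ∨-true {O u w} p
  ... | inj₁ p = let Xu , Xw , a = inX u w p in remove-⊆ X v u Xu , remove-⊆ X v w Xw , a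
  ... | inj₂ p with new⁻ u w p
  ...   | refl , Xw , a = Xv , Xw , a
  covers′ : ∀ u w → X u ≡ true → X w ≡ true → adj G u w ≡ true → O′ u w ≡ true ⊎ O′ w u ≡ true
  covers′ u w Xu Xw a = by (u ≟ v) (w ≟ v)
    where
    by : Dec (u ≡ v) → Dec (w ≡ v) → O′ u w ≡ true ⊎ O′ w u ≡ true
    by (yes refl) _          = inj₁ (∨-trueʳ (O u w) (new⁺ w Xw a))
    by (no _)     (yes refl) = inj₂ (∨-trueʳ (O w u) (new⁺ u Xu (trans (Graph.sym G w u) a)))
    by (no p)     (no q)     = case covers u w (trans (remove-other X p) Xu) (trans (remove-other X q) Xw) a of λ
      { (inj₁ h) → inj₁ (∨-trueˡ _ h) ; (inj₂ h) → inj₂ (∨-trueˡ _ h) }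

term≤sum : (g : Fin m → ℕ) → ∀ i → g i ≤ sum g
term≤sum g zero    = m≤m+n _ _
term≤sum g (suc i) = ≤-trans (term≤sum (g ∘ suc) i) (m≤n+m _ (g zero))

record GraphOrientation (G : Graph) (a : ℕ) : Set where
  field
    O      : Arcs (n G)
    as     : Asym O
    ⊆adj   : ∀ u v → O u v ≡ true → adj G u v ≡ true
    covers : ∀ u v → adj G u v ≡ true → O u v ≡ true ⊎ O v u ≡ true
    out≤   : ∀ v → outdeg O v ≤ a

-- Each edge is oriented as in the forest of its colour, and each of the `a` forests contributes at
-- most one arc leaving a vertex.
orientation : (G : Graph) (a : ℕ) → ForestColouring G a → GraphOrientation G a
orientation G a (colouring , forest) = record
  { O = O ; as = as ; ⊆adj = λ u v h → proj₁ (class⁻ (proj₂ (proj₂ (F.inX _ u v h))))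
  ; covers = covers ; out≤ = out≤ }
  where
  c = EdgeColouring.col colouring
  c-sym = EdgeColouring.colSym colouring
  class : Fin a → Arcs (n G)
  class i u v = adj G u v ∧ ⌊ c u v ≟ i ⌋
  class⁻ : ∀ {i u v} → class i u v ≡ true → adj G u v ≡ true × c u v ≡ i
  class⁻ {i} {u} {v} h with c u v ≟ i
  ... | yes e = proj₁ (∧-true {adj G u v} h) , e
  ... | no _  = contradiction (trans (≡-sym h) (Bool.∧-zeroʳ (adj G u v))) true≢false
  class⁺ : ∀ {i u v} → adj G u v ≡ true → c u v ≡ i → class i u v ≡ true
  class⁺ {i} {u} {v} h e rewrite h with c u v ≟ i
  ... | yes _ = refl
  ... | no ne = contradiction e ne
  H : Fin a → Graph
  H i = record
    { n = n G ; adj = class i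
    ; sym = λ u v → bool-≡ (back u v) (back v u)
    ; irrefl = λ v → cong (_∧ ⌊ c v v ≟ i ⌋) (irrefl G v) }
    where
    back : ∀ u v → class i u v ≡ true → class i v u ≡ true
    back u v h = let e , ci = class⁻ h in class⁺ (trans (Graph.sym G v u) e) (trans (≡-sym (c-sym u v e)) ci)
    bool-≡ : ∀ {b b′} → (b ≡ true → b′ ≡ true) → (b′ ≡ true → b ≡ true) → b ≡ b′
    bool-≡ {true}  {b′}    f g = ≡-sym (f refl)
    bool-≡ {false} {true}  f g = g refl
    bool-≡ {false} {false} f g = refl
  acyclic : ∀ i → Acyclic (H i)
  acyclic i ℓ C = forest i ℓ record
    { len≥3 = len≥3 ; vs = vs ; inj = inj
    ; edge = λ a b nx → proj₁ (class⁻ (edge a b nx)) ; prop = λ a b nx → proj₂ (class⁻ (edge a b nx)) }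
    where open CycleIn C
  module F i = ForestOrientation (orientForest (H i) (acyclic i) _ (λ _ → true) ≤-refl)
  O : Arcs (n G)
  O u v = F.O (c u v) u v
  as : Asym O
  as u v p q = F.as (c u v) u v p (subst (λ i → F.O i v u ≡ true)
    (≡-sym (c-sym u v (proj₁ (class⁻ (proj₂ (proj₂ (F.inX _ u v p))))))) q)
  covers : ∀ u v → adj G u v ≡ true → O u v ≡ true ⊎ O v u ≡ true
  covers u v e with F.covers (c u v) u v refl refl (class⁺ e refl)
  ... | inj₁ h = inj₁ h
  ... | inj₂ h = inj₂ (subst (λ i → F.O i v u ≡ true) (c-sym u v e) h)
  out≤ : ∀ v → outdeg O v ≤ a
  out≤ v = begin
    count (λ w → F.O (c v w) v w)              ≡⟨ count≡sum (O v) ⟩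
    -- The colour depends on `w`; bounding the term by the sum over all colours makes the two
    -- summations interchangeable.
    sum (λ w → 𝟙 (F.O (c v w) v w))            ≤⟨ sum-mono (λ w → term≤sum (λ i → 𝟙 (F.O i v w)) (c v w)) ⟩
    sum (λ w → sum (λ i → 𝟙 (F.O i v w)))      ≡⟨ ∑-comm (λ w i → 𝟙 (F.O i v w)) ⟩
    sum (λ i → sum (λ w → 𝟙 (F.O i v w)))      ≡⟨ sum-cong-≗ (λ i → count≡sum (F.O i v)) ⟨
    sum (λ i → outdeg (F.O i) v)               ≤⟨ sum-mono (λ i → count≤1 (F.unique i v)) ⟩
    sum {a} (λ _ → 1)                          ≡⟨ sum-const a 1 ⟩
    a * 1                                      ≡⟨ *-identityʳ a ⟩
    a                                          ∎
    where open ≤-Reasoning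

-- From arboricity and degree bounds to `d` pseudoforests

≤ceilDiv* : ∀ k b → 1 ≤ b → k ≤ ceilDiv k b * b
≤ceilDiv* k (suc b) _ = +-cancelʳ-≤ b k _ (begin
  k + b                                           ≡⟨ m≡m%n+[m/n]*n (k + b) (suc b) ⟩
  (k + b) % suc b + (k + b) / suc b * suc b       ≤⟨ +-monoˡ-≤ _ (s≤s⁻¹ (m%n<n (k + b) (suc b))) ⟩
  b + (k + b) / suc b * suc b                     ≡⟨ +-comm b _ ⟩
  (k + b) / suc b * suc b + b                     ∎)
  where open ≤-Reasoning

≤maxFin : (h : Fin m → ℕ) → ∀ i → h i ≤ maxFin h
≤maxFin h zero    = m≤m⊔n _ _
≤maxFin h (suc i) = ≤-trans (≤maxFin (h ∘ suc) i) (m≤n⊔m (h zero) _)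

degree≤ : (G : Graph) (f : Fin (n G) → ℕ) → (∀ v → 2 ≤ f v) → ∀ v → degree G v ≤ Δf G f * f v
degree≤ G f f≥2 v = ≤-trans (≤ceilDiv* (degree G v) (f v) (≤-trans (s≤s z≤n) (f≥2 v)))
                            (*-monoˡ-≤ (f v) (≤maxFin (λ v → ceilDiv (degree G v) (f v)) v))

-- Each colour class has out-degree at most 1, so a component of it contains at most one cycle, and
-- that cycle is directed.
record Pseudoforests (G : Graph) (f : Fin (n G) → ℕ) (d : ℕ) : Set where
  field
    O         : Arcs (n G)
    as        : Asym O
    ⊆adj      : ∀ u v → O u v ≡ true → adj G u v ≡ true
    covers    : ∀ u v → adj G u v ≡ true → O u v ≡ true ⊎ O v u ≡ true
    colouring : ArcColouring O d (λ v → f v ∸ 1)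

-- The capacities `d` for leaving and `d * (f v ∸ 1)` for entering arcs add up to `d * f v`, which
-- bounds the degree. Balancing requires the first not to exceed the second, and this is where
-- `2 ≤ f v` enters.
pseudoforests : (G : Graph) (f : Fin (n G) → ℕ) → (∀ v → 2 ≤ f v) → ∀ {a d} → ForestColouring G a →
                a ≤ d → (∀ v → degree G v ≤ d * f v) → Pseudoforests G f d
pseudoforests G f f≥2 {a} {d} forests a≤d deg≤ = fromOrientation (orientation G a forests)
  where
  1≤c : ∀ v → 1 ≤ f v ∸ 1
  1≤c v = ∸-monoˡ-≤ 1 (f≥2 v)
  total : ∀ v → d + d * (f v ∸ 1) ≡ d * f v
  total v = trans (≡-sym (*-suc d (f v ∸ 1))) (cong (d *_) (m+[n∸m]≡n (≤-trans (s≤s z≤n) (f≥2 v))))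
  fromBalanced : (g : GraphOrientation G a) → Balanced (GraphOrientation.O g) (λ _ → d) (λ v → d * (f v ∸ 1)) →
                 Pseudoforests G f d
  fromBalanced g b = record
    { O = arcs ; as = asym′ reorients
    ; ⊆adj = λ u v h → case from reorients h of λ { (inj₁ k) → ⊆adj u v k ; (inj₂ k) → trans (Graph.sym G u v) (⊆adj v u k) }
    ; covers = λ u v e → case covers u v e of λ { (inj₁ k) → to reorients k ; (inj₂ k) → swap⊎ (to reorients k) }
    ; colouring = arcColouring arcs d 1≤c out≤ in≤ }
    where
    open GraphOrientation g hiding (out≤)
    open Balanced b
  fromOrientation : GraphOrientation G a → Pseudoforests G f d
  fromOrientation g = fromBalanced g (balance O
    (λ v → ≤-trans (≤-reflexive (≡-sym (*-identityʳ d))) (*-monoʳ-≤ d (1≤c v)))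
    as (λ v → ≤-trans (out≤ v) a≤d) deg₀)
    where
    open GraphOrientation g
    deg₀ : ∀ v → indeg O v + outdeg O v ≤ d + d * (f v ∸ 1)
    deg₀ v = begin
      indeg O v + outdeg O v            ≡⟨ in+out as v ⟩
      count (λ u → O u v ∨ O v u)       ≤⟨ count-mono {p = λ u → O u v ∨ O v u} {adj G v} (λ u h →
                                             case ∨-true {O u v} h of λ
                                               { (inj₁ k) → trans (Graph.sym G v u) (⊆adj u v k)
                                               ; (inj₂ k) → ⊆adj v u k }) ⟩
      degree G v                        ≤⟨ deg≤ v ⟩
      d * f v                           ≡⟨ total v ⟨
      d + d * (f v ∸ 1)                 ∎
      where open ≤-Reasoning

-- Selecting one arc per cycle

unique-⊆⇒length≤ : ∀ {A : Set} {xs ys : List A} → Unique xs → (∀ {x} → x ∈ xs → x ∈ ys) → length xs ≤ length ys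
unique-⊆⇒length≤ [] _ = z≤n
unique-⊆⇒length≤ {xs = x ∷ xs} (x∉ ∷ u) sub with ps , qs , refl ← ∈-∃++ (sub (here refl)) = begin
  suc (length xs)              ≤⟨ s≤s (unique-⊆⇒length≤ u sub′) ⟩
  suc (length (ps ++ qs))      ≡⟨ cong suc (length-++ ps) ⟩
  suc (length ps + length qs)  ≡⟨ +-suc (length ps) (length qs) ⟨
  length ps + suc (length qs)  ≡⟨ length-++ ps ⟨
  length (ps ++ x ∷ qs)        ∎
  where
  open ≤-Reasoning
  sub′ : ∀ {y} → y ∈ xs → y ∈ ps ++ qs
  sub′ i with ∈-++⁻ ps (sub (there i))
  ... | inj₁ j           = ∈-++⁺ˡ j
  ... | inj₂ (here refl) = ⊥-elim (All.All¬⇒¬Any x∉ (Any.map (λ e → e) i))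
  ... | inj₂ (there j)   = ∈-++⁺ʳ ps j

-- The setting of the selection argument. Valid arcs are those on cycles, and `label` names the
-- cycle of an arc. The lists `outs` and `ins` need only contain all valid arcs at a vertex, and
-- `part ℓ` may list only some arcs of the cycle `ℓ`.
record ArcSystem : Set₁ where
  field
    E V L         : Set
    _≟E_          : DecidableEquality E
    _≟V_          : DecidableEquality V
    _≟L_          : DecidableEquality L
    tail head     : E → V
    label         : E → L
    D             : ℕ
    outs ins      : V → List E
    part          : L → List E
    Valid         : E → Set
    loopless      : ∀ {e} → Valid e → tail e ≢ head e
    outs-length   : ∀ v → length (outs v) ≤ D
    ins-length    : ∀ v → length (ins v) ≤ D
    outs-complete : ∀ {e} → Valid e → e ∈ outs (tail e)
    ins-complete  : ∀ {e} → Valid e → e ∈ ins (head e)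
    part-unique   : ∀ ℓ → Unique (part ℓ)
    part-label    : ∀ ℓ {e} → e ∈ part ℓ → label e ≡ ℓ
    part-valid    : ∀ ℓ {e} → e ∈ part ℓ → Valid e

module Selection (sys : ArcSystem) where
  open ArcSystem sys

  -- Positive length is a separate condition because `4 * D` may be zero.
  Long : L → Set
  Long ℓ = 4 * D ≤ length (part ℓ) × 0 < length (part ℓ)

  -- Distinct tails and distinct heads make the selected arcs disjoint directed paths and cycles;
  -- the strictly increasing `rank` excludes the cycles. The label conditions mean exactly one arc
  -- for each cycle in `done`.
  record Selected (done : List L) (S : List E) : Set where
    field
      valid      : ∀ {e} → e ∈ S → Valid e
      tail-inj   : ∀ {e e′} → e ∈ S → e′ ∈ S → tail e ≡ tail e′ → e ≡ e′
      head-inj   : ∀ {e e′} → e ∈ S → e′ ∈ S → head e ≡ head e′ → e ≡ e′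
      label-inj  : ∀ {e e′} → e ∈ S → e′ ∈ S → label e ≡ label e′ → e ≡ e′
      rank       : V → ℕ
      ascending  : ∀ {e} → e ∈ S → rank (tail e) < rank (head e)
      label∈     : ∀ {e} → e ∈ S → label e ∈ done
      served     : ∀ {ℓ} → ℓ ∈ done → ∃ λ e → e ∈ S × label e ≡ ℓ
  open Selected

  NoTail NoHead NoInto Free : List E → E → Set
  NoTail S e = ∀ {x} → x ∈ S → tail x ≢ tail e
  NoHead S e = ∀ {x} → x ∈ S → head x ≢ head e
  NoInto S e = ∀ {x} → x ∈ S → head x ≢ tail e
  Free S e = NoTail S e × NoHead S e × NoInto S e

  -- The index is the potential that drops whenever the blocker s of e is exchanged.
  data Blocks (S : List E) (e s : E) : ℕ → Set where
    same-tail : tail s ≡ tail e → Blocks S e s 2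
    same-head : NoTail S e → head s ≡ head e → Blocks S e s 1
    into-tail : NoTail S e → NoHead S e → head s ≡ tail e → Blocks S e s 0

  -- The bound `k` allows a new blocker of an arc to be compared with the previous one; the index
  -- records the first failing condition in the order tail, head, entering the tail.
  Status : List E → E → ℕ → Set
  Status S e k = Free S e ⊎ ∃₂ λ s k′ → s ∈ S × k′ < k × Blocks S e s k′

  status₁ : ∀ S e → NoTail S e → NoHead S e → Status S e 1
  status₁ S e nt nh with Any.any? (λ x → head x ≟V tail e) S
  ... | yes p = let s , s∈ , eq = find p in inj₂ (s , 0 , s∈ , s≤s z≤n , into-tail nt nh eq)
  ... | no none = inj₁ (nt , nh , λ x∈ eq → none (Any.map (λ { refl → eq }) x∈))

  status₂ : ∀ S e → NoTail S e → Status S e 2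
  status₂ S e nt with Any.any? (λ x → head x ≟V head e) S
  ... | yes p = let s , s∈ , eq = find p in inj₂ (s , 1 , s∈ , s≤s (s≤s z≤n) , same-head nt eq)
  ... | no none with status₁ S e nt (λ x∈ eq → none (Any.map (λ { refl → eq }) x∈))
  ...   | inj₁ free = inj₁ free
  ...   | inj₂ (s , k , s∈ , k< , b) = inj₂ (s , k , s∈ , m<n⇒m<1+n k< , b)

  status₃ : ∀ S e → Status S e 3
  status₃ S e with Any.any? (λ x → tail x ≟V tail e) S
  ... | yes p = let s , s∈ , eq = find p in inj₂ (s , 2 , s∈ , ≤-refl , same-tail eq)
  ... | no none with status₂ S e (λ x∈ eq → none (Any.map (λ { refl → eq }) x∈))
  ...   | inj₁ free = inj₁ free
  ...   | inj₂ (s , k , s∈ , k< , b) = inj₂ (s , k , s∈ , m<n⇒m<1+n k< , b)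

  -- The conditions relative to `e` ensure that selecting `x` does not block `e` again at its tail
  -- or head. Those relative to `s` ensure that a blocker of `x` differs from `s`.
  record Avoids (e s x : E) : Set where
    field
      tail≢tail : tail x ≢ tail e
      head≢head : head x ≢ head e
      tail≢tailₛ : tail x ≢ tail s
      head≢headₛ : head x ≢ head s
      tail≢headₛ : tail x ≢ head s
  open Avoids

  -- Among the five vertex conditions of Avoids two coincide whatever the kind of blocking,
  -- so at most 4 D arcs fail to avoid a step.
  blockedBy : (e s : E) → ∀ {S k} → Blocks S e s k → List E
  blockedBy e s (same-tail _)     = outs (tail e) ++ ins (head e) ++ ins (head s) ++ outs (head s)
  blockedBy e s (same-head _ _)   = outs (tail e) ++ ins (head e) ++ outs (tail s) ++ outs (head s)
  blockedBy e s (into-tail _ _ _) = outs (tail e) ++ ins (head e) ++ outs (tail s) ++ ins (head s)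

  length-++₄ : (xs ys zs ws : List E) → length xs ≤ D → length ys ≤ D → length zs ≤ D → length ws ≤ D →
               length (xs ++ ys ++ zs ++ ws) ≤ 4 * D
  length-++₄ xs ys zs ws hx hy hz hw
    rewrite length-++ xs {ys ++ zs ++ ws} | length-++ ys {zs ++ ws} | length-++ zs {ws} | +-identityʳ D =
    +-mono-≤ hx (+-mono-≤ hy (+-mono-≤ hz hw))

  blockedBy-length : ∀ {e s S k} (b : Blocks S e s k) → length (blockedBy e s b) ≤ 4 * D
  blockedBy-length {e} {s} (same-tail _) =
    length-++₄ (outs (tail e)) (ins (head e)) (ins (head s)) (outs (head s))
      (outs-length _) (ins-length _) (ins-length _) (outs-length _)
  blockedBy-length {e} {s} (same-head _ _) =
    length-++₄ (outs (tail e)) (ins (head e)) (outs (tail s)) (outs (head s))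
      (outs-length _) (ins-length _) (outs-length _) (outs-length _)
  blockedBy-length {e} {s} (into-tail _ _ _) =
    length-++₄ (outs (tail e)) (ins (head e)) (outs (tail s)) (ins (head s))
      (outs-length _) (ins-length _) (outs-length _) (ins-length _)

  unblocked⇒avoids : ∀ {e s S k} (b : Blocks S e s k) {x} → Valid x → x ∉ blockedBy e s b → Avoids e s x
  unblocked⇒avoids {e} {s} b {x} vx x∉ = by b x∉
    where
    out∈ : ∀ {v} → tail x ≡ v → x ∈ outs v
    out∈ refl = outs-complete vx
    in∈ : ∀ {v} → head x ≡ v → x ∈ ins v
    in∈ refl = ins-complete vx
    1st : ∀ {xs ys} → x ∈ xs → x ∈ xs ++ ys
    1st = ∈-++⁺ˡ
    2nd : ∀ xs {ys zs} → x ∈ ys → x ∈ xs ++ ys ++ zs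
    2nd xs i = ∈-++⁺ʳ xs (∈-++⁺ˡ i)
    3rd : ∀ xs ys {zs ws} → x ∈ zs → x ∈ xs ++ ys ++ zs ++ ws
    3rd xs ys i = ∈-++⁺ʳ xs (2nd ys i)
    4th : ∀ xs ys zs {ws} → x ∈ ws → x ∈ xs ++ ys ++ zs ++ ws
    4th xs ys zs i = ∈-++⁺ʳ xs (∈-++⁺ʳ ys (∈-++⁺ʳ zs i))
    O = outs (tail e)
    I = ins (head e)
    by : ∀ {S k} (b : Blocks S e s k) → x ∉ blockedBy e s b → Avoids e s x
    by (same-tail t) n = record
      { tail≢tail  = λ eq → n (1st (out∈ eq))
      ; head≢head  = λ eq → n (2nd O (in∈ eq))
      ; tail≢tailₛ = λ eq → n (1st (out∈ (trans eq t)))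
      ; head≢headₛ = λ eq → n (3rd O I (in∈ eq))
      ; tail≢headₛ = λ eq → n (4th O I (ins (head s)) (out∈ eq)) }
    by (same-head _ h) n = record
      { tail≢tail  = λ eq → n (1st (out∈ eq))
      ; head≢head  = λ eq → n (2nd O (in∈ eq))
      ; tail≢tailₛ = λ eq → n (3rd O I (out∈ eq))
      ; head≢headₛ = λ eq → n (2nd O (in∈ (trans eq h)))
      ; tail≢headₛ = λ eq → n (4th O I (outs (tail s)) (out∈ eq)) }
    by (into-tail _ _ h) n = record
      { tail≢tail  = λ eq → n (1st (out∈ eq))
      ; head≢head  = λ eq → n (2nd O (in∈ eq))
      ; tail≢tailₛ = λ eq → n (3rd O I (out∈ eq))
      ; head≢headₛ = λ eq → n (4th O I (outs (tail s)) (in∈ eq))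
      ; tail≢headₛ = λ eq → n (1st (out∈ (trans eq h))) }

  exchange : E → E → List E → List E
  exchange s x S = x ∷ filter (λ y → ¬? (y ≟E s)) S

  exchange⁻ : ∀ S {s x y} → y ∈ exchange s x S → y ≡ x ⊎ (y ∈ S × y ≢ s)
  exchange⁻ S     (here eq) = inj₁ eq
  exchange⁻ S {s} (there i) = inj₂ (∈-filter⁻ (λ y → ¬? (y ≟E s)) i)

  exchange⁺ : ∀ {s x S y} → y ∈ S → y ≢ s → y ∈ exchange s x S
  exchange⁺ {s} i ne = there (∈-filter⁺ (λ y → ¬? (y ≟E s)) i ne)

  -- An arc whose tail no selected arc enters can be added without closing a directed cycle:
  -- its tail becomes the unique vertex of rank 0.
  module Add {done S} (sel : Selected done S) {x} (vx : Valid x) (free : Free S x) (S′ : List E)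
             (S′⁻ : ∀ {y} → y ∈ S′ → y ≡ x ⊎ y ∈ S) where

    rank′ : V → ℕ
    rank′ v with v ≟V tail x
    ... | yes _ = 0
    ... | no _  = suc (rank sel v)

    rank-tail : rank′ (tail x) ≡ 0
    rank-tail with tail x ≟V tail x
    ... | yes _ = refl
    ... | no ne = contradiction refl ne

    rank-other : ∀ {v} → v ≢ tail x → rank′ v ≡ suc (rank sel v)
    rank-other {v} ne with v ≟V tail x
    ... | yes e = contradiction e ne
    ... | no _  = refl

    ascending′ : ∀ {y} → y ∈ S′ → rank′ (tail y) < rank′ (head y)
    ascending′ i with S′⁻ i
    ... | inj₁ refl rewrite rank-tail | rank-other (loopless vx ∘ ≡-sym) = s≤s z≤n
    ... | inj₂ j rewrite rank-other (proj₁ free j) | rank-other (proj₂ (proj₂ free) j) = s≤s (ascending sel j)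

    valid′ : ∀ {y} → y ∈ S′ → Valid y
    valid′ i with S′⁻ i
    ... | inj₁ refl = vx
    ... | inj₂ j    = valid sel j

    inj′ : ∀ {A : Set} (g : E → A) → (∀ {e e′} → e ∈ S → e′ ∈ S → g e ≡ g e′ → e ≡ e′) →
           (∀ {y} → y ∈ S → y ∈ S′ → g y ≢ g x) → ∀ {e e′} → e ∈ S′ → e′ ∈ S′ → g e ≡ g e′ → e ≡ e′
    inj′ g inj ne i i′ eq with S′⁻ i | S′⁻ i′
    ... | inj₁ refl | inj₁ refl = refl
    ... | inj₁ refl | inj₂ j′   = contradiction (≡-sym eq) (ne j′ i′)
    ... | inj₂ j    | inj₁ refl = contradiction eq (ne j i)
    ... | inj₂ j    | inj₂ j′   = inj j j′ eq

    selected : ∀ done′ → (∀ {y} → y ∈ S → y ∈ S′ → label y ≢ label x) → (∀ {y} → y ∈ S′ → label y ∈ done′) →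
               (∀ {ℓ} → ℓ ∈ done′ → ∃ λ e → e ∈ S′ × label e ≡ ℓ) → Selected done′ S′
    selected done′ label≢ lab∈ srv = record
      { valid = valid′
      ; tail-inj = inj′ tail (tail-inj sel) (λ j _ → proj₁ free j)
      ; head-inj = inj′ head (head-inj sel) (λ j _ → proj₁ (proj₂ free) j)
      ; label-inj = inj′ label (label-inj sel) label≢
      ; rank = rank′ ; ascending = ascending′ ; label∈ = lab∈ ; served = srv }

  -- Alternating trees for one further cycle

  module Serve (done : List L) (A : L) (A∉ : A ∉ done) (A-long : Long A)
               (long : ∀ {ℓ} → ℓ ∈ done → Long ℓ) where

    Goal : Set
    Goal = ∃ (Selected (A ∷ done))

    Step : Set
    Step = E × E × ℕ

    labels : List Step → List L
    labels []                = A ∷ []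
    labels ((_ , s , _) ∷ T) = label s ∷ labels T

    AvoidsAll : List Step → E → Set
    AvoidsAll T x = All (λ { (e , s , _) → Avoids e s x }) T

    -- The newest step stands first. Each considered arc lies on `A` or on the cycle of an older
    -- blocker, so once it is unblocked it can serve `A` or replace that blocker.
    data Tree (S : List E) : List Step → Set where
      []   : Tree S []
      grow : ∀ {T e s k} → Tree S T → Valid e → label e ∈ labels T → AvoidsAll T e → s ∈ S → Blocks S e s k →
             Tree S ((e , s , k) ∷ T)

    -- Each kind of blocking makes `s` share a vertex with `e` that `Avoids` keeps away from the
    -- older blockers.
    blocker-fresh : ∀ {S T e s k} → AvoidsAll T e → Blocks S e s k → All (λ { (_ , s′ , _) → s ≢ s′ }) T
    blocker-fresh []       b = []
    blocker-fresh (a ∷ as) b = distinct a b ∷ blocker-fresh as b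
      where
      distinct : ∀ {e s e′ s′ S k} → Avoids e′ s′ e → Blocks S e s k → s ≢ s′
      distinct a (same-tail t)     refl = tail≢tailₛ a (≡-sym t)
      distinct a (same-head _ h)   refl = head≢headₛ a (≡-sym h)
      distinct a (into-tail _ _ h) refl = tail≢headₛ a (≡-sym h)

    labels∈ : ∀ {S T} → Selected done S → Tree S T → ∀ {ℓ} → ℓ ∈ labels T → ℓ ∈ A ∷ done
    labels∈ sel []                     (here eq)   = here eq
    labels∈ sel (grow t _ _ _ s∈ _) (here refl) = there (label∈ sel s∈)
    labels∈ sel (grow t _ _ _ s∈ _) (there i)   = labels∈ sel t i

    -- The blockers are distinct selected arcs and so lie on distinct cycles, all of them in `done`,
    -- which does not contain `A`.
    labels-unique : ∀ {S T} → Selected done S → Tree S T → Unique (labels T)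
    labels-unique sel [] = [] ∷ []
    labels-unique {S} sel (grow {e = e} {s} t _ _ av s∈ b) = fresh t (blocker-fresh av b) ∷ labels-unique sel t
      where
      fresh : ∀ {T} → Tree S T → All (λ { (_ , s′ , _) → s ≢ s′ }) T → All (label s ≢_) (labels T)
      fresh [] [] = (λ eq → A∉ (subst (_∈ done) eq (label∈ sel s∈))) ∷ []
      fresh (grow t _ _ _ s′∈ _) (ne ∷ nes) = (λ eq → ne (label-inj sel s∈ s′∈ eq)) ∷ fresh t nes

    -- The labels of the tree are distinct members of `A ∷ done`; this bounds the fuel of the
    -- exploration.
    depth≤ : ∀ {S T} → Selected done S → Tree S T → length T ≤ length done
    depth≤ {S} {T} sel t = s≤s⁻¹ (≤-trans (≤-reflexive (≡-sym (length-labels T)))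
                                   (unique-⊆⇒length≤ (labels-unique sel t) (labels∈ sel t)))
      where
      length-labels : ∀ T → length (labels T) ≡ suc (length T)
      length-labels []      = refl
      length-labels (_ ∷ T) = cong suc (length-labels T)

    candidates : List L → List E
    candidates []       = []
    candidates (ℓ ∷ ℓs) = part ℓ ++ candidates ℓs

    candidates⁻ : ∀ ℓs {x} → x ∈ candidates ℓs → label x ∈ ℓs × Valid x
    candidates⁻ (ℓ ∷ ℓs) i with ∈-++⁻ (part ℓ) i
    ... | inj₁ j = here (part-label ℓ j) , part-valid ℓ j
    ... | inj₂ j = let l∈ , v = candidates⁻ ℓs j in there l∈ , v

    candidates-unique : ∀ {ℓs} → Unique ℓs → Unique (candidates ℓs)
    candidates-unique [] = []
    candidates-unique {ℓ ∷ ℓs} (ℓ∉ ∷ u) = Unique.++⁺ (part-unique ℓ) (candidates-unique u)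
      λ { (i , j) → All.All¬⇒¬Any ℓ∉ (subst (_∈ ℓs) (part-label ℓ i) (proj₁ (candidates⁻ ℓs j))) }

    blocked : ∀ {S T} → Tree S T → List E
    blocked []                                 = []
    blocked (grow {e = e} {s} t _ _ _ _ b) = blockedBy e s b ++ blocked t

    -- Each step forbids at most `4 * D` arcs and brings in a cycle with at least as many listed
    -- arcs. The arcs of `A` are the surplus that makes the inequality strict.
    blocked<candidates : ∀ {S T} → Selected done S → (t : Tree S T) → length (blocked t) < length (candidates (labels T))
    blocked<candidates sel [] rewrite length-++ (part A) {[]} = ≤-trans (proj₂ A-long) (m≤m+n _ 0)
    blocked<candidates sel (grow {T} {e} {s} t _ _ _ s∈ b)
      rewrite length-++ (blockedBy e s b) {blocked t} | length-++ (part (label s)) {candidates (labels T)} =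
      +-mono-≤-< (≤-trans (blockedBy-length b) (proj₁ (long (label∈ sel s∈)))) (blocked<candidates sel t)

    unblocked⇒avoidsAll : ∀ {S T} (t : Tree S T) {x} → Valid x → x ∉ blocked t → AvoidsAll T x
    unblocked⇒avoidsAll [] vx x∉ = []
    unblocked⇒avoidsAll (grow {e = e} {s} t _ _ _ _ b) vx x∉ =
      unblocked⇒avoids b vx (x∉ ∘ ∈-++⁺ˡ) ∷ unblocked⇒avoidsAll t vx (x∉ ∘ ∈-++⁺ʳ (blockedBy e s b))

    nextArc : ∀ {S T} → Selected done S → Tree S T → ∃ λ x → Valid x × label x ∈ labels T × AvoidsAll T x
    nextArc {S} {T} sel t with All.all? (λ x → Any.any? (x ≟E_) (blocked t)) (candidates (labels T))
    ... | yes all = contradiction (unique-⊆⇒length≤ (candidates-unique (labels-unique sel t)) (All.lookup all))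
                                  (<⇒≱ (blocked<candidates sel t))
    ... | no ¬all =
      let x , x∈ , x∉ = find (All.¬All⇒Any¬ (λ x → Any.any? (x ≟E_) (blocked t)) _ ¬all)
          l∈ , vx = candidates⁻ (labels T) x∈
      in x , vx , l∈ , unblocked⇒avoidsAll t vx x∉

    -- For each step of the tree, how to continue once the tree is cut back to that step and the
    -- blocker of the step is exchanged for one of smaller index.
    Handler : List Step → Set
    Handler []                = ⊤
    Handler ((e , s , k) ∷ T) =
      (∀ {S′ s′ k′} → k′ < k → Selected done S′ → Tree S′ ((e , s′ , k′) ∷ T) → Goal) × Handler T

    module Exchange {S} (sel : Selected done S) {s x} (s∈ : s ∈ S) (vx : Valid x) (free : Free S x)
                    (same : label x ≡ label s) where
      S′ : List E
      S′ = exchange s x S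

      sel′ : Selected done S′
      sel′ = Add.selected sel vx free S′ (λ i → case exchange⁻ S i of λ { (inj₁ e) → inj₁ e ; (inj₂ (j , _)) → inj₂ j })
        done label≢ lab∈ srv
        where
        label≢ : ∀ {y} → y ∈ S → y ∈ S′ → label y ≢ label x
        label≢ i i′ eq with exchange⁻ S i′
        ... | inj₁ refl     = proj₁ free i refl
        ... | inj₂ (_ , ne) = ne (label-inj sel i s∈ (trans eq same))
        lab∈ : ∀ {y} → y ∈ S′ → label y ∈ done
        lab∈ i with exchange⁻ S i
        ... | inj₁ refl    = subst (_∈ done) (≡-sym same) (label∈ sel s∈)
        ... | inj₂ (j , _) = label∈ sel j
        srv : ∀ {ℓ} → ℓ ∈ done → ∃ λ e → e ∈ S′ × label e ≡ ℓ
        srv ℓ∈ with served sel ℓ∈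
        ... | e , e∈ , eq with e ≟E s
        ...   | yes refl = x , here refl , trans same eq
        ...   | no ne    = e , exchange⁺ e∈ ne , eq

      keep : ∀ {A : Set} (g h : E → A) {e} → g x ≢ h e → (∀ {y} → y ∈ S → g y ≢ h e) → ∀ {y} → y ∈ S′ → g y ≢ h e
      keep g h nx nS i with exchange⁻ S i
      ... | inj₁ refl    = nx
      ... | inj₂ (j , _) = nS j

      -- By injectivity `s` was the only selected arc violating the condition, so its removal
      -- establishes it.
      clear : ∀ {A : Set} (g h : E → A) {e} → (∀ {e e′} → e ∈ S → e′ ∈ S → g e ≡ g e′ → e ≡ e′) →
              g x ≢ h e → g s ≡ h e → ∀ {y} → y ∈ S′ → g y ≢ h e
      clear g h inj nx gs i eq with exchange⁻ S i
      ... | inj₁ refl     = nx eq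
      ... | inj₂ (j , ne) = ne (inj j s∈ (trans eq (≡-sym gs)))

      -- The older blockers differ from `s` and stay selected, and `x` avoids the older steps, so
      -- the recorded absences at tails and heads persist.
      tree′ : ∀ {T} → AvoidsAll T x → All (λ { (_ , s′ , _) → s ≢ s′ }) T → Tree S T → Tree S′ T
      tree′ [] [] [] = []
      tree′ (a ∷ as) (ne ∷ nes) (grow t ve l∈ av s′∈ b) =
        grow (tree′ as nes t) ve l∈ av (exchange⁺ s′∈ (ne ∘ ≡-sym)) (blocks b)
        where
        blocks : ∀ {k} → Blocks S _ _ k → Blocks S′ _ _ k
        blocks (same-tail e)        = same-tail e
        blocks (same-head nt e)     = same-head (keep tail tail (tail≢tail a) nt) e
        blocks (into-tail nt nh e)  = into-tail (keep tail tail (tail≢tail a) nt) (keep head head (head≢head a) nh) e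

      -- The exchange repairs the condition that `s` violated and keeps the earlier ones, so a new
      -- blocker of `e` has a smaller index.
      status′ : ∀ {e k} → Avoids e s x → Blocks S e s k → Status S′ e k
      status′ {e} a (same-tail t) = status₂ S′ e (clear tail tail (tail-inj sel) (tail≢tail a) t)
      status′ {e} a (same-head nt h) =
        status₁ S′ e (keep tail tail (tail≢tail a) nt) (clear head head (head-inj sel) (head≢head a) h)
      status′ {e} a (into-tail nt nh h) =
        inj₁ (keep tail tail (tail≢tail a) nt , keep head head (head≢head a) nh ,
              clear head tail (head-inj sel) (λ eq → head≢headₛ a (trans eq (≡-sym h))) h)

    -- If the free arc `x` lies on `A`, it completes the selection. Otherwise it replaces the
    -- blocker on its own cycle; the arc `e` of that step is then free, and is placed in turn in the
    -- older tree, or has a blocker of smaller index, and the handler takes over.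
    place : ∀ {S T x} → Selected done S → Tree S T → Valid x → label x ∈ labels T → AvoidsAll T x → Free S x →
            Handler T → Goal
    place {S} {x = x} sel [] vx (here eq) _ free _ =
      x ∷ S , Add.selected sel vx free (x ∷ S) (λ { (here e) → inj₁ e ; (there j) → inj₂ j }) (A ∷ done)
        (λ i _ e → A∉ (subst (_∈ done) (trans e eq) (label∈ sel i)))
        (λ { (here refl) → here eq ; (there j) → there (label∈ sel j) })
        (λ { (here refl) → x , here refl , eq
           ; (there j) → let e , e∈ , le = served sel j in e , there e∈ , le })
    -- The cycle of `x` belongs to an older step or to `A`, so the newest step is discarded.
    place sel (grow t _ _ _ _ _) vx (there i) (_ ∷ as) free (_ , hs) = place sel t vx i as free hs
    place sel (grow t ve l∈ av s∈ b) vx (here eq) (a ∷ as) free (h , hs) = continue (status′ a b)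
      where
      open Exchange sel s∈ vx free eq
      t′ = tree′ as (blocker-fresh av b) t
      continue : Status S′ _ _ → Goal
      continue (inj₁ free′) = place sel′ t′ ve l∈ av free′ hs
      continue (inj₂ (s′ , k′ , s′∈ , k′< , b′)) = h k′< sel′ (grow t′ ve l∈ av s′∈ b′)

    -- Termination is lexicographic. Growing the tree consumes `fuel`, which suffices since the
    -- depth is at most `length done`; exchanging the blocker of a step lowers `bound`, a limit on
    -- its index, and restores the fuel available at that step.
    explore : ∀ fuel {S T} → suc (length done) ≤ fuel + length T → Selected done S → Tree S T → Handler T → Goal
    descend : ∀ fuel bound {S T e s k} → suc (length done) ≤ fuel + suc (length T) → k ≤ bound →
              Selected done S → Tree S ((e , s , k) ∷ T) → Handler T → Goal
    explore zero       le sel t hs = contradiction (depth≤ sel t) (<⇒≱ le)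
    explore (suc fuel) {S} {T} le sel t hs with nextArc sel t
    ... | x , vx , l∈ , av with status₃ S x
    ...   | inj₁ free = place sel t vx l∈ av free hs
    ...   | inj₂ (s , k , s∈ , _ , b) =
      descend fuel k (≤-trans le (≤-reflexive (≡-sym (+-suc fuel (length T))))) ≤-refl sel (grow t vx l∈ av s∈ b) hs
    -- No index lies below zero, so the handler of this step can never be called.
    descend fuel zero        le k≤ sel t hs = explore fuel le sel t ((λ k′< → contradiction (≤-trans k′< k≤) λ ()) , hs)
    descend fuel (suc bound) le k≤ sel t hs = explore fuel le sel t
      ((λ k′< sel′ t′ → descend fuel bound le (s≤s⁻¹ (≤-trans k′< k≤)) sel′ t′ hs) , hs)

    serve : ∀ {S} → Selected done S → Goal
    serve sel = explore (suc (length done)) (m≤m+n _ 0) sel [] tt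

  select : ∀ ℓs → (∀ {ℓ} → ℓ ∈ ℓs → Long ℓ) → ∃ (Selected ℓs)
  select [] _ = [] , record
    { valid = λ () ; tail-inj = λ () ; head-inj = λ () ; label-inj = λ () ; rank = λ _ → 0
    ; ascending = λ () ; label∈ = λ () ; served = λ () }
  select (ℓ ∷ ℓs) long with select ℓs (long ∘ there)
  ... | S , sel with Any.any? (ℓ ≟L_) ℓs
  ...   | no ℓ∉  = Serve.serve ℓs ℓ ℓ∉ (long (here refl)) (long ∘ there) sel
  -- Repetitions have to be allowed: the list used later contains the label of a cycle once for each
  -- of its arcs.
  ...   | yes ℓ∈ = S , record
    { valid = valid sel ; tail-inj = tail-inj sel ; head-inj = head-inj sel ; label-inj = label-inj sel
    ; rank = rank sel ; ascending = ascending sel ; label∈ = there ∘ label∈ sel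
    ; served = λ { (here refl) → served sel ℓ∈ ; (there i) → served sel i } }

-- Cycles of the colour classes

minUpTo : (ℕ → ℕ) → ℕ → ℕ
minUpTo g zero    = g 0
minUpTo g (suc k) = minUpTo g k ⊓ g (suc k)

minUpTo-≤ : ∀ g k {r} → r ≤ k → minUpTo g k ≤ g r
minUpTo-≤ g zero    z≤n = ≤-refl
minUpTo-≤ g (suc k) {r} le with r ℕ.≟ suc k
... | yes refl = m⊓n≤n _ _
... | no ne    = ≤-trans (m⊓n≤m _ _) (minUpTo-≤ g k (s≤s⁻¹ (≤∧≢⇒< le ne)))

minUpTo-attained : ∀ g k → ∃ λ r → minUpTo g k ≡ g r
minUpTo-attained g zero = 0 , refl
minUpTo-attained g (suc k) with ⊓-sel (minUpTo g k) (g (suc k))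
... | inj₁ e = let r , e′ = minUpTo-attained g k in r , trans e e′
... | inj₂ e = suc k , e

-- Periodic points and orbits of a self-map

module Iteration (φ : Fin N → Fin N) where

  iter : ℕ → Fin N → Fin N
  iter zero    v = v
  iter (suc k) v = φ (iter k v)

  iter-+ : ∀ a b v → iter (a + b) v ≡ iter a (iter b v)
  iter-+ zero    b v = refl
  iter-+ (suc a) b v = cong φ (iter-+ a b v)

  iter-φ : ∀ k v → iter k (φ v) ≡ φ (iter k v)
  iter-φ zero    v = refl
  iter-φ (suc k) v = cong φ (iter-φ k v)

  iter-* : ∀ q p v → iter p v ≡ v → iter (q * p) v ≡ v
  iter-* zero    p v eq = refl
  iter-* (suc q) p v eq = trans (iter-+ p (q * p) v) (trans (cong (iter p) (iter-* q p v eq)) eq)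

  -- The period is taken between 1 and `N`, which makes periodicity decidable by finite search.
  Periodic : Fin N → Set
  Periodic v = ∃ λ (k : Fin N) → iter (suc (toℕ k)) v ≡ v

  periodic-φ : ∀ {v} → Periodic v → Periodic (φ v)
  periodic-φ {v} (k , eq) = k , trans (iter-φ (suc (toℕ k)) v) (cong φ eq)

  periodic-iter : ∀ m {v} → Periodic v → Periodic (iter m v)
  periodic-iter zero    p = p
  periodic-iter (suc m) p = periodic-φ (periodic-iter m p)

  -- The product of the two periods fixes both points; it equals `suc M`, so applying `iter M` to
  -- the common image recovers each of them.
  φ-injective : ∀ {u v} → Periodic u → Periodic v → φ u ≡ φ v → u ≡ v
  φ-injective {u} {v} (k , p) (l , q) eq = begin
    u                              ≡⟨ iter-* (suc (toℕ l)) (suc (toℕ k)) u p ⟨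
    iter (suc (toℕ l) * suc (toℕ k)) u   ≡⟨ iter-φ M u ⟨
    iter M (φ u)                   ≡⟨ cong (iter M) eq ⟩
    iter M (φ v)                   ≡⟨ iter-φ M v ⟩
    iter (suc (toℕ l) * suc (toℕ k)) v   ≡⟨ cong (λ z → iter z v) (*-comm (suc (toℕ l)) (suc (toℕ k))) ⟩
    iter (suc (toℕ k) * suc (toℕ l)) v   ≡⟨ iter-* (suc (toℕ k)) (suc (toℕ l)) v q ⟩
    v                              ∎
    where
    open ≡-Reasoning
    M = toℕ k + toℕ l * suc (toℕ k)

  reduce : ∀ {v k} → iter (suc k) v ≡ v → ∀ m → ∃ λ r → r ≤ k × iter m v ≡ iter r v
  reduce p zero = 0 , z≤n , refl
  reduce {v} {k} p (suc m) with reduce p m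
  ... | r , r≤ , eq with r ℕ.≟ k
  ...   | yes refl = 0 , z≤n , trans (cong φ eq) p
  ...   | no ne    = suc r , ≤∧≢⇒< r≤ ne , cong φ eq

  return : ∀ {v} → Periodic v → ∀ m → ∃ λ x → iter x (iter m v) ≡ v
  return {v} (k , p) m =
    let r , r≤ , eq = reduce p m in suc (toℕ k) ∸ r , (begin
      iter (suc (toℕ k) ∸ r) (iter m v)   ≡⟨ cong (iter (suc (toℕ k) ∸ r)) eq ⟩
      iter (suc (toℕ k) ∸ r) (iter r v)   ≡⟨ iter-+ (suc (toℕ k) ∸ r) r v ⟨
      iter (suc (toℕ k) ∸ r + r) v        ≡⟨ cong (λ z → iter z v) (m∸n+n≡m (m≤n⇒m≤1+n r≤)) ⟩
      iter (suc (toℕ k)) v                ≡⟨ p ⟩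
      v                                   ∎)
    where open ≡-Reasoning

  -- A canonical name for the orbit of a periodic point: the least index occurring on it. As periods
  -- are at most `N`, the inspected iterates cover the whole orbit.
  orbitMin : Fin N → ℕ
  orbitMin v = minUpTo (λ r → toℕ (iter r v)) N

  orbitMin-≤ : ∀ {v} → Periodic v → ∀ m → orbitMin v ≤ toℕ (iter m v)
  orbitMin-≤ {v} (k , p) m = let r , r≤ , eq = reduce p m in
    ≤-trans (minUpTo-≤ (λ r → toℕ (iter r v)) N (≤-trans r≤ (<⇒≤ (toℕ<n k)))) (≤-reflexive (cong toℕ (≡-sym eq)))

  orbitMin-φ : ∀ {v} → Periodic v → orbitMin (φ v) ≡ orbitMin v
  orbitMin-φ {v} p = ≤-antisym ≤₁ ≤₂
    where
    ≤₁ : orbitMin (φ v) ≤ orbitMin v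
    ≤₁ = let r , e = minUpTo-attained (λ r → toℕ (iter r v)) N
             x , back = return p 1
         in ≤-trans (orbitMin-≤ (periodic-φ p) (r + x))
              (≤-reflexive (trans (cong toℕ (trans (iter-+ r x (φ v)) (cong (iter r) back))) (≡-sym e)))
    ≤₂ : orbitMin v ≤ orbitMin (φ v)
    ≤₂ = let r , e = minUpTo-attained (λ r → toℕ (iter r (φ v))) N in
         ≤-trans (orbitMin-≤ p (suc r)) (≤-reflexive (trans (cong toℕ (≡-sym (iter-φ r v))) (≡-sym e)))

  orbitMin-iter : ∀ m {v} → Periodic v → orbitMin (iter m v) ≡ orbitMin v
  orbitMin-iter zero    p = refl
  orbitMin-iter (suc m) p = trans (orbitMin-φ (periodic-iter m p)) (orbitMin-iter m p)

  -- Both orbits pass through the vertex whose index is the common minimum, and from there the orbit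
  -- of `u` returns to `u`.
  same-orbit : ∀ {u v} → Periodic u → orbitMin u ≡ orbitMin v → ∃ λ m → u ≡ iter m v
  same-orbit {u} {v} p eq =
    let r , e  = minUpTo-attained (λ r → toℕ (iter r u)) N
        s , e′ = minUpTo-attained (λ r → toℕ (iter r v)) N
        x , back = return p r
        meet = toℕ-injective (trans (≡-sym e) (trans eq e′))
    in x + s , trans (≡-sym back) (trans (cong (iter x) meet) (≡-sym (iter-+ x s v)))

-- Two arcs of the cycle cannot both leave their common vertex, so a backward arc forces all later arcs
-- to be backward.
module Direct {G : Graph} {P : Fin (n G) → Fin (n G) → Set} (Arc : Fin (n G) → Fin (n G) → Set)
  (functional : ∀ {u v w} → Arc u v → Arc u w → v ≡ w) (asym : ∀ {u v} → Arc u v → Arc v u → ⊥)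
  (orient : ∀ {u v} → adj G u v ≡ true → P u v → Arc u v ⊎ Arc v u) where

  record DirectedCycle (ℓ : ℕ) : Set where
    field
      z      : ℕ → Fin (n G)
      arcs   : ∀ k → k < ℓ → Arc (z k) (z (suc k))
      closed : z ℓ ≡ z 0

  directed : ∀ {ℓ} → CycleIn G P ℓ → DirectedCycle ℓ
  directed {zero}   C = contradiction (CycleIn.len≥3 C) λ ()
  directed {suc ℓ′} C = conclude (pair 0)
    where
    open CycleIn C
    ℓ = suc ℓ′
    nextBy : ∀ a → Dec (suc (toℕ a) < ℓ) → Fin ℓ
    nextBy a (yes lt) = fromℕ< lt
    nextBy a (no _)   = zero
    next : Fin ℓ → Fin ℓ
    next a = nextBy a (suc (toℕ a) <? ℓ)
    last : ∀ (a : Fin ℓ) → ¬ suc (toℕ a) < ℓ → suc (toℕ a) ≡ ℓ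
    last a nlt = ≤-antisym (toℕ<n a) (≮⇒≥ nlt)
    next-cyc : ∀ a → CycNext a (next a)
    next-cyc a with suc (toℕ a) <? ℓ
    ... | yes lt = inj₁ (≡-sym (toℕ-fromℕ< lt))
    ... | no nlt = inj₂ (last a nlt , refl)
    -- Two steps along a cycle of length at least 3 never return to the start.
    cyc²-≢ : ∀ {a b c : Fin ℓ} → CycNext a b → CycNext b c → a ≢ c
    cyc²-≢ {a} (inj₁ p) (inj₁ q) refl = m≢1+n+m (toℕ a) {1} (≡-sym (trans (cong suc p) q))
    cyc²-≢ (inj₁ p) (inj₂ (q , r)) refl = <⇒≢ len≥3 (trans (cong suc (trans (cong suc (≡-sym r)) p)) q)
    cyc²-≢ (inj₂ (p , r)) (inj₁ q) refl = <⇒≢ len≥3 (trans (cong suc (trans (cong suc (≡-sym r)) q)) p)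
    cyc²-≢ (inj₂ (p , r)) (inj₂ (q , s)) refl = <⇒≢ (≤-trans (s≤s (s≤s z≤n)) len≥3) (trans (cong suc (≡-sym s)) p)
    pos : ℕ → Fin ℓ
    pos zero    = zero
    pos (suc k) = next (pos k)
    y : ℕ → Fin (n G)
    y = vs ∘ pos
    pos-toℕ : ∀ k → k < ℓ → toℕ (pos k) ≡ k
    pos-toℕ zero    _  = refl
    pos-toℕ (suc k) lt with next-cyc (pos k)
    ... | inj₁ e = trans (≡-sym e) (cong suc (pos-toℕ k (<⇒≤ lt)))
    ... | inj₂ (e , _) = contradiction (trans (cong suc (≡-sym (pos-toℕ k (<⇒≤ lt)))) e) (<⇒≢ lt)
    pos-ℓ : pos ℓ ≡ zero
    pos-ℓ with next-cyc (pos ℓ′)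
    ... | inj₁ e = contradiction (trans (≡-sym e) (cong suc (pos-toℕ ℓ′ ≤-refl))) (<⇒≢ (toℕ<n (next (pos ℓ′))))
    ... | inj₂ (_ , e) = toℕ-injective e
    turn : ∀ k → y k ≢ y (suc (suc k))
    turn k eq = cyc²-≢ (next-cyc (pos k)) (next-cyc (pos (suc k))) (inj eq)
    pair : ∀ k → Arc (y k) (y (suc k)) ⊎ Arc (y (suc k)) (y k)
    pair k = orient (edge _ _ (next-cyc (pos k))) (prop _ _ (next-cyc (pos k)))
    backward : ∀ k → Arc (y (suc k)) (y k) → ∀ m → Arc (y (suc (m + k))) (y (m + k))
    backward k b zero = b
    backward k b (suc m) with pair (suc (m + k))
    ... | inj₁ a = contradiction (functional (backward k b m) a) (turn (m + k))
    ... | inj₂ a = a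
    conclude : Arc (y 0) (y 1) ⊎ Arc (y 1) (y 0) → DirectedCycle ℓ
    conclude (inj₁ f) = record { z = y ; arcs = forward ; closed = cong vs pos-ℓ }
      where
      forward : ∀ k → k < ℓ → Arc (y k) (y (suc k))
      forward k lt with pair k
      ... | inj₁ a = a
      -- A backward arc at `k` propagates to position `ℓ`, which is position 0 again, where the arc
      -- runs forward.
      ... | inj₂ b = ⊥-elim (asym f (subst (λ p → Arc (vs (next p)) (vs p)) pos-ℓ
              (subst (λ m → Arc (y (suc m)) (y m)) (m∸n+n≡m (<⇒≤ lt)) (backward k b (ℓ ∸ k)))))
    -- If the first arc is backward, then all are, and the cycle is traversed in the opposite sense.
    conclude (inj₂ b) = record
      { z = λ k → y (ℓ ∸ k)
      ; arcs = λ k lt → subst (λ m → Arc (y m) (y (ℓ ∸ suc k))) (suc-∸ lt)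
          (subst (λ m → Arc (y (suc m)) (y m)) (+-identityʳ (ℓ ∸ suc k)) (backward 0 b (ℓ ∸ suc k)))
      ; closed = trans (cong y (n∸n≡0 ℓ)) (≡-sym (cong vs pos-ℓ)) }
      where
      suc-∸ : ∀ {a b} → a < b → suc (b ∸ suc a) ≡ b ∸ a
      suc-∸ {zero}  {suc b} _  = refl
      suc-∸ {suc a} {suc b} lt = suc-∸ (s≤s⁻¹ lt)

-- Applying the selection and assembling the `d + 1` forests

module Final (G : Graph) (f : Fin (n G) → ℕ) (f≥2 : ∀ v → 2 ≤ f v) {d : ℕ}
  (pseudo : Pseudoforests G f d) (girth : GirthAtLeast G (4 * d)) where

  open Pseudoforests pseudo
  open ArcColouring colouring
  open Proper proper

  V : Set
  V = Fin (n G)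

  κ-unique : ∀ {i u v w} → κ u v ≡ just i → κ u w ≡ just i → v ≡ w
  κ-unique {i} {u} p q = count≤1⇒unique {p = λ w → isColour (κ u w) i} (out≤1 i u) _ _ (isColour⁺ p) (isColour⁺ q)

  κ-asym : ∀ {u v i j} → κ u v ≡ just i → κ v u ≡ just j → ⊥
  κ-asym {u} {v} p q = as u v (sound u v p) (sound v u q)

  successor? : ∀ i v → Dec (∃ λ w → κ v w ≡ just i)
  successor? i v = any? (λ w → ≡-dec _≟_ (κ v w) (just i))

  -- The unique successor in class `i`; a vertex without one is made a fixed point by default.
  φ : Fin d → V → V
  φ i v with successor? i v
  ... | yes (w , _) = w
  ... | no _        = v

  φ-arc : ∀ {i v w} → κ v w ≡ just i → φ i v ≡ w
  φ-arc {i} {v} {w} p with successor? i v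
  ... | yes (_ , q) = κ-unique q p
  ... | no none     = contradiction (w , p) none

  arc-or-fixed : ∀ i v → κ v (φ i v) ≡ just i ⊎ φ i v ≡ v
  arc-or-fixed i v with successor? i v
  ... | yes (_ , q) = inj₁ q
  ... | no _        = inj₂ refl

  open module It i = Iteration (φ i)

  -- Out-degree at most 1 in each class means that tail and colour determine an arc.
  E : Set
  E = V × Fin d

  -- The first condition excludes the fixed points that `φ` creates by default, which are periodic
  -- without lying on a cycle.
  Cyclic : E → Set
  Cyclic (v , i) = κ v (φ i v) ≡ just i × Periodic i v

  cyclic? : ∀ e → Dec (Cyclic e)
  cyclic? (v , i) = ≡-dec _≟_ (κ v (φ i v)) (just i) ×-dec any? (λ k → iter i (suc (toℕ k)) v ≟ v)

  cyclic-φ : ∀ {v i} → Cyclic (v , i) → Cyclic (φ i v , i)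
  cyclic-φ {v} {i} (arc , p) with arc-or-fixed i (φ i v)
  ... | inj₁ arc′  = arc′ , periodic-φ i p
  ... | inj₂ fixed = ⊥-elim (κ-asym arc (subst₂ (λ a b → κ a b ≡ just i) fix (≡-sym fix) arc))
    where
    fix : v ≡ φ i v
    fix = ≡-sym (φ-injective i (periodic-φ i p) p fixed)

  cyclic-iter : ∀ {v i} k → Cyclic (v , i) → Cyclic (iter i k v , i)
  cyclic-iter zero    c = c
  cyclic-iter (suc k) c = cyclic-φ (cyclic-iter k c)

  -- A repetition within fewer than `4 * d` steps would be a closed walk, without turning back by
  -- asymmetry, and would contain a cycle shorter than the girth permits.
  iter-distinct : ∀ {v i} → Cyclic (v , i) → ∀ {a b} → a < b → b < 4 * d → iter i a v ≢ iter i b v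
  iter-distinct {v} {i} c {a} {b} a<b b< eq =
    let ℓ , ℓ≤ , C = closedWalk⇒cycle G (λ _ _ → ⊤) x (λ k → ⊆adj _ _ (sound _ _ (arc k))) (λ _ → tt)
                       (λ k e → κ-asym (arc k) (subst (λ w → κ (x (suc k)) w ≡ just i) (≡-sym e) (arc (suc k))))
                       a (b ∸ a) (m<n⇒0<n∸m a<b) (trans (cong x (m+[n∸m]≡n (<⇒≤ a<b))) (≡-sym eq))
    in <-irrefl refl (≤-<-trans (≤-trans (girth ℓ C) (≤-trans ℓ≤ (m∸n≤m b a))) b<)
    where
    x : ℕ → V
    x k = iter i k v
    arc : ∀ k → κ (x k) (x (suc k)) ≡ just i
    arc k = proj₁ (cyclic-iter k c)

  label : E → ℕ × Fin d
  label (v , i) = orbitMin i v , i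

  predecessor? : ∀ i w → Dec (∃ λ v → Cyclic (v , i) × φ i v ≡ w)
  predecessor? i w = any? (λ v → cyclic? (v , i) ×-dec (φ i v ≟ w))

  -- A class may have many arcs entering `w`, but at most one of them lies on a cycle. Hence `d`
  -- predecessors account for all cyclic arcs entering `w`; the default value `w` only pads this
  -- list.
  pred : Fin d → V → V
  pred i w with predecessor? i w
  ... | yes (v , _) = v
  ... | no _        = w

  pred-φ : ∀ {v i} → Cyclic (v , i) → pred i (φ i v) ≡ v
  pred-φ {v} {i} c with predecessor? i (φ i v)
  ... | yes (u , c′ , e) = φ-injective i (proj₂ c′) (proj₂ c) e
  ... | no none          = contradiction (v , c , refl) none

  representative? : ∀ ℓ i → Dec (∃ λ v → Cyclic (v , i) × orbitMin i v ≡ ℓ)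
  representative? ℓ i = any? (λ v → cyclic? (v , i) ×-dec (orbitMin i v ℕ.≟ ℓ))

  -- The first `4 * d` arcs from a chosen vertex of the cycle suffice; they are distinct by the
  -- girth. A label that names no cycle gets the empty list.
  part : ℕ × Fin d → List E
  part (ℓ , i) with representative? ℓ i
  ... | yes (v , _) = applyUpTo (λ k → iter i k v , i) (4 * d)
  ... | no _        = []

  part-unique : ∀ ℓ → Unique (part ℓ)
  part-unique (ℓ , i) with representative? ℓ i
  ... | yes (v , c , _) = Unique.applyUpTo⁺₁ _ (4 * d) (λ a<b b< e → iter-distinct c a<b b< (cong proj₁ e))
  ... | no _            = []

  part⁻ : ∀ ℓ {e} → e ∈ part ℓ → label e ≡ ℓ × Cyclic e
  part⁻ (ℓ , i) e∈ with representative? ℓ i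
  ... | yes (v , c , refl) with k , _ , refl ← ∈-applyUpTo⁻ (λ k → iter i k v , i) e∈ =
    cong (_, i) (orbitMin-iter i k (proj₂ c)) , cyclic-iter k c
  part⁻ (ℓ , i) () | no _

  part-length : ∀ {v i} → Cyclic (v , i) → length (part (label (v , i))) ≡ 4 * d
  part-length {v} {i} c with representative? (orbitMin i v) i
  ... | yes (u , _) = length-applyUpTo (λ k → iter i k u , i) (4 * d)
  ... | no none     = contradiction (v , c , refl) none

  system : ArcSystem
  system = record
    { E = E ; V = V ; L = ℕ × Fin d
    ; _≟E_ = Prod.≡-dec _≟_ _≟_ ; _≟V_ = _≟_ ; _≟L_ = Prod.≡-dec ℕ._≟_ _≟_
    ; tail = proj₁ ; head = λ { (v , i) → φ i v } ; label = label ; D = d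
    ; outs = λ v → map (v ,_) (allFin d)
    ; ins = λ w → map (λ i → pred i w , i) (allFin d)
    ; part = part ; Valid = Cyclic
    ; loopless = λ { {v , i} (arc , _) e → κ-asym arc (subst₂ (λ a b → κ a b ≡ just i) e (≡-sym e) arc) }
    ; outs-length = λ v → ≤-reflexive (trans (length-map (v ,_) (allFin d)) (length-tabulate (λ i → i)))
    ; ins-length = λ w → ≤-reflexive (trans (length-map (λ i → pred i w , i) (allFin d)) (length-tabulate (λ i → i)))
    ; outs-complete = λ { {v , i} _ → ∈-map⁺ (v ,_) (∈-allFin i) }
    ; ins-complete = λ { {v , i} c → subst (λ u → (u , i) ∈ map (λ j → pred j (φ i v) , j) (allFin d)) (pred-φ c)
                                       (∈-map⁺ (λ j → pred j (φ i v) , j) (∈-allFin i)) }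
    ; part-unique = part-unique
    ; part-label = λ ℓ e∈ → proj₁ (part⁻ ℓ e∈)
    ; part-valid = λ ℓ e∈ → proj₂ (part⁻ ℓ e∈) }

  module Sel = Selection system

  cyclicArcs : List E
  cyclicArcs = filter cyclic? (cartesianProduct (allFin (n G)) (allFin d))

  cycles : List (ℕ × Fin d)
  cycles = map label cyclicArcs

  cycles-long : ∀ {ℓ} → ℓ ∈ cycles → Sel.Long ℓ
  cycles-long ℓ∈ with ∈-map⁻ label ℓ∈
  ... | (v , i) , e∈ , refl =
    let c = proj₂ (∈-filter⁻ cyclic? {xs = cartesianProduct (allFin (n G)) (allFin d)} e∈) in
    ≤-reflexive (≡-sym (part-length c)) ,
    -- The colour `i` of the arc witnesses that `d` is positive.
    ≤-trans (≤-trans (s≤s z≤n) (toℕ<n i)) (≤-trans (m≤n*m d 4) (≤-reflexive (≡-sym (part-length c))))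

  module Colour {S : List E} (selected : Sel.Selected cycles S) where
    open Sel.Selected selected
    open DecMembership {A = E} (Prod.≡-dec _≟_ _≟_) using (_∈?_)

    removed? : ∀ u v → Dec (∃ λ i → (u , i) ∈ S × φ i u ≡ v)
    removed? u v = any? (λ i → ((u , i) ∈? S) ×-dec (φ i u ≟ v))

    removed : V → V → Bool
    removed u v = ⌊ removed? u v ⌋

    removed⁻ : ∀ {u v} → removed u v ≡ true → ∃ λ i → (u , i) ∈ S × φ i u ≡ v
    removed⁻ {u} {v} h with removed? u v
    ... | yes p = p

    removed⁺ : ∀ {u i} → (u , i) ∈ S → removed u (φ i u) ≡ true
    removed⁺ {u} {i} e∈ with removed? u (φ i u)
    ... | yes _   = refl
    ... | no none = contradiction (i , e∈ , refl) none

    removed-functional : ∀ {u v w} → removed u v ≡ true → removed u w ≡ true → v ≡ w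
    removed-functional p q with removed⁻ p | removed⁻ q
    ... | i , i∈ , refl | j , j∈ , refl with tail-inj i∈ j∈ refl
    ...   | refl = refl

    removed-injective : ∀ {u v w} → removed u w ≡ true → removed v w ≡ true → u ≡ v
    removed-injective p q with removed⁻ p | removed⁻ q
    ... | i , i∈ , eq | j , j∈ , eq′ = cong proj₁ (head-inj i∈ j∈ (trans eq (≡-sym eq′)))

    removed-ascending : ∀ {u v} → removed u v ≡ true → rank u < rank v
    removed-ascending p with removed⁻ p
    ... | i , i∈ , refl = ascending i∈

    -- At most one direction of an edge is coloured, so the order of the alternatives does not
    -- matter and the result is symmetric.
    base : V → V → Maybe (Fin d)
    base u v = κ u v <∣> κ v u

    base-sym : ∀ u v → base u v ≡ base v u
    base-sym u v with κ u v in p | κ v u in q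
    ... | just _  | just _  = ⊥-elim (κ-asym p q)
    ... | just _  | nothing = refl
    ... | nothing | just _  = refl
    ... | nothing | nothing = refl

    base⁻ : ∀ {u v i} → base u v ≡ just i → κ u v ≡ just i ⊎ κ v u ≡ just i
    base⁻ {u} {v} h with κ u v
    ... | just _  = inj₁ h
    ... | nothing = inj₂ h

    base-complete : ∀ {u v} → adj G u v ≡ true → base u v ≢ nothing
    base-complete {u} {v} e with κ u v in p | κ v u in q
    ... | just _  | _       = λ ()
    ... | nothing | just _  = λ ()
    ... | nothing | nothing with covers u v e
    ...   | inj₁ o = contradiction (trans (≡-sym p) (proj₂ (complete u v o))) λ ()
    ...   | inj₂ o = contradiction (trans (≡-sym q) (proj₂ (complete v u o))) λ ()

    -- Colour `zero` is the additional class of removed arcs. The value for `nothing` is a default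
    -- that never occurs on an edge.
    newColour : Bool → Maybe (Fin d) → Fin (suc d)
    newColour r k = if r then zero else maybe′ suc zero k

    c : EdgeColouring G (suc d)
    c = record
      { col    = λ u v → newColour (removed u v ∨ removed v u) (base u v)
      ; colSym = λ u v _ → cong₂ newColour (Bool.∨-comm (removed u v) (removed v u)) (base-sym u v) }

    col-zero : ∀ {u v} → adj G u v ≡ true → col c u v ≡ zero → removed u v ≡ true ⊎ removed v u ≡ true
    col-zero {u} {v} e h with removed u v | removed v u
    ... | true  | _    = inj₁ refl
    ... | false | true = inj₂ refl
    ... | false | false with base u v in b
    ...   | nothing = contradiction b (base-complete e)
    col-zero e () | false | false | just _

    col-suc : ∀ {u v i} → col c u v ≡ suc i →
              (κ u v ≡ just i × removed u v ≡ false) ⊎ (κ v u ≡ just i × removed v u ≡ false)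
    col-suc {u} {v} {i} h with removed u v | removed v u
    col-suc () | true  | _
    col-suc () | false | true
    ... | false | false with base u v in b
    ...   | just j with base⁻ b | suc-injective h
    ...     | inj₁ k | refl = inj₁ (k , refl)
    ...     | inj₂ k | refl = inj₂ (k , refl)

    class⁻ : ∀ {u v i} → adj G u v ∧ ⌊ col c u v ≟ i ⌋ ≡ true → adj G u v ≡ true × col c u v ≡ i
    class⁻ {u} {v} {i} h with adj G u v | col c u v ≟ i
    ... | true | yes e = refl , e

    inClass : Fin (suc d) → V → V → Bool
    inClass i v w = adj G v w ∧ ⌊ col c v w ≟ i ⌋

    -- Removed arcs form directed paths, which gives degree at most 2; any other class has at most 1
    -- leaving and `f v ∸ 1` entering arcs.
    degree-bound : ∀ i v → colDegree c i v ≤ f v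
    degree-bound zero v = begin
      count (inClass zero v)                          ≤⟨ count-∪ {p = inClass zero v} {removed v} {λ w → removed w v}
                                                           (λ w h → let e , z = class⁻ {v} {w} h in col-zero e z) ⟩
      count (removed v) + count (λ w → removed w v)   ≤⟨ +-mono-≤ (count≤1 (λ _ _ → removed-functional))
                                                                   (count≤1 (λ _ _ → removed-injective)) ⟩
      2                                               ≤⟨ f≥2 v ⟩
      f v                                             ∎
      where open ≤-Reasoning
    degree-bound (suc i) v = begin
      count (inClass (suc i) v)    ≤⟨ count-∪ {p = inClass (suc i) v} {λ w → isColour (κ v w) i} {λ w → isColour (κ w v) i}
                                        split ⟩
      outCol κ i v + inCol κ i v   ≤⟨ +-mono-≤ (out≤1 i v) (in≤ i v) ⟩
      1 + (f v ∸ 1)                ≡⟨ m+[n∸m]≡n (≤-trans (s≤s z≤n) (f≥2 v)) ⟩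
      f v                          ∎
      where
      open ≤-Reasoning
      split : ∀ w → inClass (suc i) v w ≡ true → isColour (κ v w) i ≡ true ⊎ isColour (κ w v) i ≡ true
      split w h with col-suc {v} {w} (proj₂ (class⁻ {v} {w} h))
      ... | inj₁ (k , _) = inj₁ (isColour⁺ k)
      ... | inj₂ (k , _) = inj₂ (isColour⁺ k)

    -- A cycle in class `zero` would be directed, and `rank` would increase all the way around it. A
    -- cycle in another class would be an orbit of `φ i` from which an arc was removed.
    forest : ∀ i → ClassIsForest c i
    forest zero ℓ C = <-irrefl refl (≤-trans (m<m+n _ (≤-trans (s≤s z≤n) (CycleIn.len≥3 C)))
      (≤-trans (climb ℓ ≤-refl) (≤-reflexive (cong rank closed))))
      where
      open Direct {P = λ u v → col c u v ≡ zero} (λ u v → removed u v ≡ true) removed-functional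
        (λ p q → <-asym (removed-ascending p) (removed-ascending q)) col-zero
      open DirectedCycle (directed C)
      climb : ∀ k → k ≤ ℓ → rank (z 0) + k ≤ rank (z k)
      climb zero    _  = ≤-reflexive (+-identityʳ _)
      climb (suc k) le = ≤-trans (≤-reflexive (+-suc _ k)) (≤-trans (s≤s (climb k (<⇒≤ le))) (removed-ascending (arcs k le)))
    forest (suc i) zero    C = contradiction (CycleIn.len≥3 C) λ ()
    forest (suc i) (suc l) C = hit (served (∈-map⁺ label
      (∈-filter⁺ cyclic? (∈-cartesianProduct⁺ (∈-allFin (z 0)) (∈-allFin i)) z₀-cyclic)))
      where
      open Direct {P = λ u v → col c u v ≡ suc i} (λ u v → κ u v ≡ just i × removed u v ≡ false)
        (λ p q → κ-unique (proj₁ p) (proj₁ q)) (λ p q → κ-asym (proj₁ p) (proj₁ q)) (λ _ → col-suc)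
      open DirectedCycle (directed C)
      z-iter : ∀ k → k ≤ suc l → z k ≡ iter i k (z 0)
      z-iter zero    _  = refl
      z-iter (suc k) le = trans (≡-sym (φ-arc (proj₁ (arcs k le)))) (cong (φ i) (z-iter k (<⇒≤ le)))
      return₀ : iter i (suc l) (z 0) ≡ z 0
      return₀ = trans (≡-sym (z-iter (suc l) ≤-refl)) closed
      -- The vertices of the cycle are distinct, so its length is within the range of periods that
      -- `Periodic` allows.
      l<n : l < n G
      l<n = injective⇒≤ (CycleIn.inj C)
      z₀-cyclic : Cyclic (z 0 , i)
      z₀-cyclic = subst (λ w → κ (z 0) w ≡ just i) (z-iter 1 (s≤s z≤n)) (proj₁ (arcs 0 (s≤s z≤n))) ,
                  fromℕ< l<n , subst (λ k → iter i (suc k) (z 0) ≡ z 0) (≡-sym (toℕ-fromℕ< l<n)) return₀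
      hit : (∃ λ e → e ∈ S × label e ≡ label (z 0 , i)) → ⊥
      hit ((w , j) , e∈ , eq) with cong proj₂ eq
      ... | refl =
        -- The selected arc with the label of this cycle starts on the same orbit, hence at some
        -- position `r` of the cycle; but the arc there was kept.
        let m , w≡ = same-orbit i (proj₂ (valid e∈)) (cong proj₁ eq)
            r , r≤ , m≡ = reduce i return₀ m
            w≡z = trans w≡ (trans m≡ (≡-sym (z-iter r (m≤n⇒m≤1+n r≤))))
            arc , kept = arcs r (s≤s r≤)
        in contradiction (trans (≡-sym (removed⁺ (subst (λ u → (u , i) ∈ S) w≡z e∈)))
             (trans (cong (removed (z r)) (φ-arc arc)) kept)) true≢false

    colouring′ : DegFForestColouring G f (suc d)
    colouring′ = c , λ i → forest i , degree-bound i

  result : DegFForestColouring G f (suc d)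
  result = Colour.colouring′ (proj₂ (Sel.select cycles cycles-long))

theorem6 : (G : Graph) (f : Fin (n G) → ℕ) → (∀ v → 2 ≤ f v) →
    (a : ℕ) → IsArboricity G a →
    GirthAtLeast G (4 * (Δf G f ⊔ a)) →
    DegFForestColouring G f (suc (Δf G f ⊔ a))
theorem6 G f f≥2 a (forests , _) girth = Final.result G f f≥2
  (pseudoforests G f f≥2 forests (m≤n⊔m (Δf G f) a)
    (λ v → ≤-trans (degree≤ G f f≥2 v) (*-monoˡ-≤ (f v) (m≤m⊔n (Δf G f) a)))) girth
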